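{- Suppose the metric grouping $\mathcal G$ is order-compatible and $0\le C<F^w_{[n]}$. Then the bounded fractional knapsack problem admits an optimal solution $z^\star$ with $z^\star_i=u_i$ for $i\in\Gamma^-$, $z^\star_i=0$ for $i\in\Gamma^+$, and $\sum_{i\in\Gamma}w_iz^\star_i=c^\star$. Consequently $z^\star$ and $z^{\mathrm{gp}}$ coincide outside $\Gamma$, and $$E(C)=\Delta_\Gamma(c^\star)\ \le\ U_\Gamma\Bigl(\widehat v_\Gamma\,\frac{w^+_\Gamma-w^-_\Gamma}{w^+_\Gamma+w^-_\Gamma}+\varepsilon_v\Bigr).$$ If $|G_k|\le K$ for every $k$, then $$\frac{E(C)}{n}\ \le\ \frac Kn\Bigl(\frac{\widehat v_\Gamma L_w}{w_{\min}}+L_v\Bigr)\delta\ =\ \mathcal O\Bigl(\frac Kn\Bigr),$$ uniformly over any family of instances (with fixed $L_v,L_w,\delta$) for which $\widehat v_\Gamma\le\bar V$ and $w_{\min}\ge\bar w>0$. Furthermore, if $C>0$, the relative loss satisfies $$\frac{E(C)}{V^\star(C)}\ \le\ \frac{U_\Gamma}{C}\cdot\frac{\widehat v_\Gamma}{\nu^\star}\Bigl(\frac{w^+_\Gamma-w^-_\Gamma}{w^+_\Gamma+w^-_\Gamma}+\frac{\varepsilon_v}{\widehat v_\Gamma}\Bigr).$$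
   Context: Instance: $[n]=\{0,\dots,n-1\}$; item $i$ has ceiling $u_i\in[0,1]$ and attribute $a_i$ in a metric space $(A,d)$; $v:A\to(0,v_{\max}]$ and $w:A\to[w_{\min},\infty)$, $w_{\min}>0$, are Lipschitz with constants $L_v,L_w$; $v_i=v(a_i)$, $w_i=w(a_i)$, $\rho_i=v_i/w_i$; budget $C\ge0$. For $S\subseteq[n]$, $U_S=\sum_{i\in S}u_i$, $F^w_S=\sum_{i\in S}w_iu_i$. The bounded fractional knapsack problem is $V^\star(C)=\max\sum_iv_iz_i$ over $z$ with $0\le z_i\le u_i$, $\sum_iw_iz_i\le C$. Multiplier $\nu^\star$: a number $\nu^\star\ge0$ such that for an optimal $z$ one has $\nu^\star(C-\sum_iw_iz_i)=0$, $z_i=u_i$ whenever $\rho_i>\nu^\star$, and $z_i=0$ whenever $\rho_i<\nu^\star$ (such a $\nu^\star$ exists, and is positive when $C<F^w_{[n]}$). A metric grouping with tolerance $\delta>0$ is a partition $\mathcal G=\{G_0,\dots,G_{m-1}\}$ of $[n]$ into non-empty sets with representatives $\widehat a_k\in A$, $d(a_i,\widehat a_k)\le\delta$ for $i\in G_k$. Put $\widehat v_k=v(\widehat a_k)$, $\widehat\rho_k=v(\widehat a_k)/w(\widehat a_k)$, $w^-_k=\min_{i\in G_k}w_i$, $w^+_k=\max_{i\in G_k}w_i$, $\varepsilon_v=L_v\delta$; groups are indexed so that $\widehat\rho_0\ge\dots\ge\widehat\rho_{m-1}$. It is order-compatible if $\min_{i\in G_k}\rho_i\ge\max_{l\in G_{k'}}\rho_l$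 for all $k<k'$. Grouped allocation: $F^w_{\le k}=\sum_{j\le k}F^w_{G_j}$, $F^w_{\le-1}=0$, $k^\star=\min\{k:F^w_{\le k}>C\}$, $c^\star=C-F^w_{\le k^\star-1}$, $\Gamma=G_{k^\star}$ (boundary group; subscript $\Gamma$ means the quantity for $k=k^\star$), $\Gamma^-=\bigcup_{j<k^\star}G_j$, $\Gamma^+=\bigcup_{j>k^\star}G_j$. For a group $G$ and $c\in[0,F^w_G]$, the water-filling allocation $z^{\mathrm{wf}}(c)\in\mathbb R^G$ is $z^{\mathrm{wf}}_i=\min\{u_i,\zeta\}$ with $\zeta\in[0,\max_{i\in G}u_i]$ the unique solution of $\sum_{i\in G}w_i\min\{u_i,\zeta\}=c$. Then $z^{\mathrm{gp}}_i=u_i$ on $\Gamma^-$, $z^{\mathrm{gp}}_i=0$ on $\Gamma^+$, and $z^{\mathrm{gp}}|_\Gamma=z^{\mathrm{wf}}(c^\star)$. $V^{\mathrm{gp}}(C)=\sum_iv_iz^{\mathrm{gp}}_i$ and $E(C)=V^\star(C)-V^{\mathrm{gp}}(C)$. Intra-group loss: $\Delta_G(c)=\max\{\sum_{i\in G}v_iz_i:0\le z_i\le u_i,\ \sum_{i\in G}w_iz_i\le c\}-\sum_{i\in G}v_iz^{\mathrm{wf}}_i(c)$. -}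

module Defs where

open import Level using (Level; _⊔_) renaming (suc to lsuc)
open import Algebra.Bundles using (CommutativeRing)
open import Data.Bool.Base using (if_then_else_)
open import Data.Fin.Base as Fin using (Fin)
import Data.Fin.Properties as Fin
open import Data.Fin.Subset as Subset using (Subset; _∈_; Nonempty)
open import Data.Fin.Subset.Properties using (_∈?_)
open import Data.List.Base as List using (List)
open import Data.Nat.Base as ℕ using (ℕ)
open import Data.Product using (_×_; _,_; proj₁; ∃; ∃!)
open import Function.Metric.Structures using (IsGeneralMetric)
open import Relation.Binary.Bundles using (DecTotalOrder; TotalOrder)
open import Relation.Binary.Core using (Rel)
open import Relation.Binary.Definitions using (tri<; tri≈; tri>)
open import Relation.Binary.PropositionalEquality.Core using (_≡_)
open import Relation.Binary.Structures using (IsDecTotalOrder)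
open import Relation.Nullary.Decidable.Core using (does)
open import Relation.Nullary.Negation.Core using (¬_)
import Algebra.Construct.NaturalChoice.Max
import Algebra.Construct.NaturalChoice.Min
import Algebra.Properties.CommutativeMonoid.Sum
import Algebra.Properties.Semiring.Mult
import Data.List.Extrema
import Relation.Binary.Construct.NonStrictToStrict

-- Linearly ordered fields; the real numbers of classical mathematics are the
-- complete example.  Nothing below refers to completeness, so scalars range
-- over an arbitrary such field.

record OrderedField (c ℓ₁ ℓ₂ : Level) : Set (lsuc (c ⊔ ℓ₁ ⊔ ℓ₂)) where
  field
    commutativeRing : CommutativeRing c ℓ₁

  open CommutativeRing commutativeRing public

  infix 4 _≤_
  infix 8 _⁻¹

  field
    _≤_             : Rel Carrier ℓ₂
    isDecTotalOrder : IsDecTotalOrder _≈_ _≤_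
    +-monoʳ-≤       : ∀ x {y z} → y ≤ z → x + y ≤ x + z
    *-nonNegative   : ∀ {x y} → 0# ≤ x → 0# ≤ y → 0# ≤ x * y
    0≉1             : ¬ (0# ≈ 1#)
    -- A total operation, so that quotients need no side proof; its value at 0#
    -- is unconstrained.
    _⁻¹             : Carrier → Carrier
    *-inverseʳ      : ∀ {x} → ¬ (x ≈ 0#) → x * x ⁻¹ ≈ 1#

  decTotalOrder : DecTotalOrder c ℓ₁ ℓ₂
  decTotalOrder = record { isDecTotalOrder = isDecTotalOrder }

  open DecTotalOrder decTotalOrder public using (totalOrder)

  open Relation.Binary.Construct.NonStrictToStrict _≈_ _≤_ public using (_<_)
  open Algebra.Construct.NaturalChoice.Min totalOrder public using (_⊓_)
  open Algebra.Construct.NaturalChoice.Max totalOrder public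
    using () renaming (_⊔_ to _⊔′_)
  open Algebra.Properties.CommutativeMonoid.Sum +-commutativeMonoid public
    using (sum)
  open Algebra.Properties.Semiring.Mult semiring
    using () renaming (_×_ to _·_)

  infixl 7 _/_

  _/_ : Carrier → Carrier → Carrier
  x / y = x * y ⁻¹

  ∣_∣ : Carrier → Carrier
  ∣ x ∣ = x ⊔′ (- x)

  fromℕ : ℕ → Carrier
  fromℕ k = k · 1#

  sumOver : ∀ {n} → Subset n → (Fin n → Carrier) → Carrier
  sumOver S f = sum (λ i → if does (i ∈? S) then f i else 0#)

  infixl 10 sumOver
  syntax sumOver S (λ i → x) = ∑[ i ∈ S ] x

  private
    image : ∀ {n} → Subset n → (Fin n → Carrier) → List Carrier
    image S f = List.map f (List.filter (_∈? S) (List.allFin _))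

  -- The element witnessing non-emptiness only serves as the starting value.

  minOver maxOver : ∀ {n} (S : Subset n) → Nonempty S → (Fin n → Carrier) → Carrier
  minOver S (i₀ , _) f = Data.List.Extrema.min totalOrder (f i₀) (image S f)
  maxOver S (i₀ , _) f = Data.List.Extrema.max totalOrder (f i₀) (image S f)

  IsMaximum : ∀ {x p} {X : Set x} → (X → Set p) → (X → Carrier) → Carrier →
              Set (x ⊔ p ⊔ ℓ₁ ⊔ ℓ₂)
  IsMaximum P f μ = (∃ λ x → P x × f x ≈ μ) × (∀ x → P x → f x ≤ μ)

module Knapsack {c ℓ₁ ℓ₂ : Level} (𝔽 : OrderedField c ℓ₁ ℓ₂) where

  open OrderedField 𝔽

  record Instance (a ℓ : Level) (Lᵥ L_w : Carrier)
                  : Set (lsuc (a ⊔ ℓ) ⊔ c ⊔ ℓ₁ ⊔ ℓ₂) where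
    infix 4 _≈ᴬ_
    field
      A           : Set a
      _≈ᴬ_        : Rel A ℓ
      d           : A → A → Carrier
      isMetric    : IsGeneralMetric _≈ᴬ_ _≈_ _≤_ 0# _+_ d
      vᴬ wᴬ       : A → Carrier
      vₘₐₓ wₘᵢₙ   : Carrier
      vᴬ-positive : ∀ x → 0# < vᴬ x
      vᴬ-bounded  : ∀ x → vᴬ x ≤ vₘₐₓ
      wₘᵢₙ-positive : 0# < wₘᵢₙ
      wᴬ-bounded  : ∀ x → wₘᵢₙ ≤ wᴬ x
      Lᵥ-nonNegative : 0# ≤ Lᵥ
      L_w-nonNegative : 0# ≤ L_w
      vᴬ-lipschitz : ∀ x y → ∣ vᴬ x - vᴬ y ∣ ≤ Lᵥ * d x y
      wᴬ-lipschitz : ∀ x y → ∣ wᴬ x - wᴬ y ∣ ≤ L_w * d x y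
      n           : ℕ
      u           : Fin n → Carrier
      attr        : Fin n → A
      u-nonNegative : ∀ i → 0# ≤ u i
      u≤1         : ∀ i → u i ≤ 1#
      C           : Carrier
      C-nonNegative : 0# ≤ C

    v w ρ : Fin n → Carrier
    v i = vᴬ (attr i)
    w i = wᴬ (attr i)
    ρ i = v i / w i

    [n] : Subset n
    [n] = Subset.⊤

    value weight : Subset n → (Fin n → Carrier) → Carrier
    value  S z = ∑[ i ∈ S ] (v i * z i)
    weight S z = ∑[ i ∈ S ] (w i * z i)

    U F : Subset n → Carrier
    U S = ∑[ i ∈ S ] u i
    F S = weight S u

    -- An element of ℝ^S is represented by a vector indexed by all items whose
    -- entries outside S are ignored.

    Feasible : Subset n → Carrier → (Fin n → Carrier) → Set ℓ₂
    Feasible S b z = (∀ i → i ∈ S → 0# ≤ z i × z i ≤ u i) × weight S z ≤ b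

    IsMaxValue : Subset n → Carrier → Carrier → Set (c ⊔ ℓ₁ ⊔ ℓ₂)
    IsMaxValue S b = IsMaximum (Feasible S b) (value S)

    IsV⋆ : Carrier → Set (c ⊔ ℓ₁ ⊔ ℓ₂)
    IsV⋆ = IsMaxValue [n] C

    Optimal : (Fin n → Carrier) → Set (c ⊔ ℓ₂)
    Optimal z = Feasible [n] C z × (∀ z′ → Feasible [n] C z′ → value [n] z′ ≤ value [n] z)

    IsMultiplier : Carrier → Set (c ⊔ ℓ₁ ⊔ ℓ₂)
    IsMultiplier ν =
      0# ≤ ν ×
      ∃ λ z → Optimal z
            × ν * (C - weight [n] z) ≈ 0#
            × (∀ i → ν < ρ i → z i ≈ u i)
            × (∀ i → ρ i < ν → z i ≈ 0#)

    record WaterLevel (S : Subset n) (S≠∅ : Nonempty S) (b : Carrier)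
                      : Set (c ⊔ ℓ₁ ⊔ ℓ₂) where
      field
        ζ             : Carrier
        ζ-nonNegative : 0# ≤ ζ
        ζ≤max         : ζ ≤ maxOver S S≠∅ u

      allocation : Fin n → Carrier
      allocation i = u i ⊓ ζ

      field
        fills : weight S allocation ≈ b

    IsIntraGroupLoss : ∀ {S S≠∅ b} → WaterLevel S S≠∅ b → Carrier → Set (c ⊔ ℓ₁ ⊔ ℓ₂)
    IsIntraGroupLoss {S} {_} {b} wl Δ =
      ∃ λ μ → IsMaxValue S b μ × Δ ≈ μ - value S (WaterLevel.allocation wl)

  record MetricGrouping {a ℓ : Level} {Lᵥ L_w : Carrier} (I : Instance a ℓ Lᵥ L_w)
                        (δ : Carrier) : Set (a ⊔ ℓ₁ ⊔ ℓ₂) where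
    open Instance I
    field
      δ-positive : 0# < δ
      m          : ℕ
      G          : Fin m → Subset n
      nonempty   : ∀ k → Nonempty (G k)
      partition  : ∀ i → ∃! _≡_ (λ k → i ∈ G k)
      rep        : Fin m → A
      rep-close  : ∀ k i → i ∈ G k → d (attr i) (rep k) ≤ δ

    ρ̂ : Fin m → Carrier
    ρ̂ k = vᴬ (rep k) / wᴬ (rep k)

    field
      sorted : ∀ k k′ → k Fin.≤ k′ → ρ̂ k′ ≤ ρ̂ k

    v̂ w⁻ w⁺ : Fin m → Carrier
    v̂ k = vᴬ (rep k)
    w⁻ k = minOver (G k) (nonempty k) w
    w⁺ k = maxOver (G k) (nonempty k) w

    εᵥ : Carrier
    εᵥ = Lᵥ * δ

    groupOf : Fin n → Fin m
    groupOf i = proj₁ (partition i)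

    OrderCompatible : Set ℓ₂
    OrderCompatible = ∀ k k′ → k Fin.< k′ →
      maxOver (G k′) (nonempty k′) ρ ≤ minOver (G k) (nonempty k) ρ

    -- F< k is F≤ at the preceding index, with the convention that it vanishes
    -- when k is the first group.

    F≤ F< : Fin m → Carrier
    F≤ k = sum (λ j → if does (j Fin.≤? k) then F (G j) else 0#)
    F< k = sum (λ j → if does (j Fin.<? k) then F (G j) else 0#)

  record GroupedAllocation {a ℓ : Level} {Lᵥ L_w δ : Carrier} {I : Instance a ℓ Lᵥ L_w}
                           (𝒢 : MetricGrouping I δ) : Set (c ⊔ ℓ₁ ⊔ ℓ₂) where
    open Instance I
    open MetricGrouping 𝒢
    field
      k⋆         : Fin m
      k⋆-exceeds : C < F≤ k⋆
      k⋆-least   : ∀ k → C < F≤ k → k⋆ Fin.≤ k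

    c⋆ : Carrier
    c⋆ = C - F< k⋆

    Γ : Subset n
    Γ = G k⋆

    field
      waterLevel : WaterLevel Γ (nonempty k⋆) c⋆

    infix 4 _∈Γ⁻ _∈Γ⁺

    _∈Γ⁻ _∈Γ⁺ : Fin n → Set
    i ∈Γ⁻ = ∃ λ j → j Fin.< k⋆ × i ∈ G j
    i ∈Γ⁺ = ∃ λ j → k⋆ Fin.< j × i ∈ G j

    zᵍᵖ : Fin n → Carrier
    zᵍᵖ i with Fin.<-cmp (groupOf i) k⋆
    ... | tri< _ _ _ = u i
    ... | tri≈ _ _ _ = WaterLevel.allocation waterLevel i
    ... | tri> _ _ _ = 0#

    Vᵍᵖ : Carrier
    Vᵍᵖ = value [n] zᵍᵖ

    spread : Carrier
    spread = (w⁺ k⋆ - w⁻ k⋆) / (w⁺ k⋆ + w⁻ k⋆)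

    sizeBound : ℕ → Carrier
    sizeBound K = fromℕ K / fromℕ n * (v̂ k⋆ * L_w / wₘᵢₙ + Lᵥ) * δ

{-# OPTIONS --safe #-}
module Submission where

open import Defs
open import Level using (Level)
open import Algebra.Bundles using (CommutativeRing)
open import Algebra.Solver.Ring.AlmostCommutativeRing
  using (fromCommutativeRing; _-Raw-AlmostCommutative⟶_)
open import Data.Bool.Base using (if_then_else_)
open import Data.Fin.Base as Fin using (Fin; zero; suc)
import Data.Fin.Properties as Fin
open import Data.Fin.Subset using (Subset; Nonempty; _∈_; _∉_; ⊤; inside; outside) renaming (∣_∣ to card)
open import Data.Fin.Subset.Properties using (_∈?_; ∈⊤)
open import Data.Integer.Base as ℤ using (ℤ; +_; -[1+_])
import Data.Integer.Properties as ℤ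
open import Data.List.Base using (List; allFin; filter; map)
open import Data.List.Membership.Propositional using () renaming (_∈_ to _∈ᴸ_)
open import Data.List.Membership.Propositional.Properties
  using (∈-allFin; ∈-filter⁺; ∈-filter⁻; ∈-map⁺)
open import Data.List.Relation.Unary.All as All using (All)
import Data.List.Relation.Unary.All.Properties as All
open import Data.Maybe.Base as Maybe using ()
open import Data.Nat.Base as ℕ using (ℕ; zero; suc) renaming (_≤_ to _≤ℕ_)
import Data.Nat.Properties as ℕ
open import Data.Product using (_×_; _,_; proj₁; proj₂; ∃; ∃!)
open import Data.Sign.Base as Sign using (Sign)
open import Data.Sum.Base using (inj₁; inj₂)
open import Data.Vec.Base using ([]; _∷_)
open import Function.Base using (_∘_)
open import Relation.Binary.Bundles using (DecTotalOrder; StrictTotalOrder)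
open import Relation.Binary.Definitions using (tri<; tri≈; tri>)
open import Relation.Binary.PropositionalEquality.Core as ≡ using (_≡_)
open import Relation.Nullary.Decidable.Core using (Dec; yes; no; does; dec⇒maybe; _×-dec_)
open import Relation.Nullary.Negation.Core using (¬_; contradiction)
open import Relation.Unary using (Decidable)
import Algebra.Construct.NaturalChoice.Max
import Algebra.Construct.NaturalChoice.Min
import Algebra.Properties.CommutativeSemigroup
import Algebra.Properties.Ring
import Algebra.Properties.Semiring.Mult
import Algebra.Properties.Semiring.Sum
import Algebra.Solver.Ring
import Data.List.Extrema
import Relation.Binary.Construct.NonStrictToStrict
import Relation.Binary.Properties.DecTotalOrder
import Relation.Binary.Reasoning.PartialOrder
import Relation.Binary.Reasoning.Setoid

-- Every threshold allocation (u above a ratio ν, 0 below it, budget exhausted) is optimal,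
-- because (v - ν w)(z - z′) ≥ 0 itemwise.  The greedy solution of the boundary group alone
-- has such a threshold, and order compatibility makes it a threshold for all items once
-- the better groups are filled and the worse ones left empty.  Hence the loss is that of
-- the boundary group, where two allocations of equal weight are compared: with p, q the
-- extreme weights and D = Σ (y - y′), the itemwise inequality
-- (p + q)(y - y′) ≤ (p - q) u + 2 w (y - y′) sums to (p + q) D ≤ (p - q) U, and replacing
-- v by v̂ costs at most εᵥ U.  The relative bound uses V⋆ ≥ ν⋆ C.

-- Scalars come from an arbitrary ordered field, so an optimum cannot be taken from compactness, nor
-- a threshold from the intermediate value theorem. The critical ratio is therefore searched for
-- among the finitely many `ρ i`, and the remaining budget is met exactly by solving one linear
-- equation. The factor `(p - q) / (p + q)` comes from measuring weights from their midpoint. Since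
-- `w (y - y′)` sums to zero, `(p + q) D` is the sum of `(p + q - 2 w)(y - y′)`, whose first factor
-- lies between `-(p - q)` and `p - q` and whose second lies between `-u` and `u`. Measuring from
-- the largest weight would leave only `p` in the denominator.

-- Integer coefficients for the ring solver

module IntegerCoefficients {c ℓ} (R : CommutativeRing c ℓ) where

  open CommutativeRing R
  open Algebra.Properties.Ring ring
  open Algebra.Properties.Semiring.Mult semiring using (×-homo-+; ×1-homo-*)
    renaming (_×_ to _·_)
  open Algebra.Properties.CommutativeSemigroup +-commutativeSemigroup
    using () renaming (interchange to +-interchange)
  open Algebra.Properties.CommutativeSemigroup *-commutativeSemigroup
    using () renaming (interchange to *-interchange)
  open Relation.Binary.Reasoning.Setoid setoid

  ⟦_⟧ : ℤ → Carrier
  ⟦ + n ⟧      = n · 1#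
  ⟦ -[1+ n ] ⟧ = - (suc n · 1#)

  -- Integer addition of mixed signs unfolds to `⊖`, so this carries both mixed cases of `⟦⟧-+`. The
  -- recursive case inserts `1# - 1#`.
  ⟦⟧-⊖ : ∀ m n → ⟦ m ℤ.⊖ n ⟧ ≈ m · 1# - n · 1#
  ⟦⟧-⊖ zero    zero    = sym (-‿inverseʳ 0#)
  ⟦⟧-⊖ zero    (suc n) = sym (+-identityˡ _)
  ⟦⟧-⊖ (suc m) zero    = sym (trans (+-congˡ -0#≈0#) (+-identityʳ _))
  ⟦⟧-⊖ (suc m) (suc n) = begin
    ⟦ suc m ℤ.⊖ suc n ⟧                     ≡⟨ ≡.cong ⟦_⟧ (ℤ.[1+m]⊖[1+n]≡m⊖n m n) ⟩
    ⟦ m ℤ.⊖ n ⟧                             ≈⟨ ⟦⟧-⊖ m n ⟩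
    m · 1# - n · 1#                         ≈⟨ +-identityˡ _ ⟨
    0# + (m · 1# - n · 1#)                  ≈⟨ +-congʳ (-‿inverseʳ 1#) ⟨
    (1# - 1#) + (m · 1# - n · 1#)           ≈⟨ +-interchange _ _ _ _ ⟩
    suc m · 1# + (- 1# - n · 1#)            ≈⟨ +-congˡ (-‿+-comm _ _) ⟩
    suc m · 1# - suc n · 1#                 ∎

  ⟦⟧-+ : ∀ i j → ⟦ i ℤ.+ j ⟧ ≈ ⟦ i ⟧ + ⟦ j ⟧
  ⟦⟧-+ (+ m)      (+ n)      = ×-homo-+ 1# m n
  ⟦⟧-+ (+ m)      -[1+ n ]   = ⟦⟧-⊖ m (suc n)
  ⟦⟧-+ -[1+ m ]   (+ n)      = trans (⟦⟧-⊖ n (suc m)) (+-comm _ _)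
  ⟦⟧-+ -[1+ m ]   -[1+ n ]   = begin
    - (suc (suc (m ℕ.+ n)) · 1#)      ≈⟨ -‿cong (+-congˡ (×-homo-+ 1# (suc m) n)) ⟩
    - (1# + (suc m · 1# + n · 1#))    ≈⟨ -‿cong (x∙yz≈y∙xz _ _ _) ⟩
    - (suc m · 1# + suc n · 1#)       ≈⟨ -‿+-comm _ _ ⟨
    - (suc m · 1#) - suc n · 1#       ∎
    where open Algebra.Properties.CommutativeSemigroup +-commutativeSemigroup

  ⟦⟧-neg : ∀ i → ⟦ ℤ.- i ⟧ ≈ - ⟦ i ⟧
  ⟦⟧-neg (+ zero)   = sym -0#≈0#
  ⟦⟧-neg (+ suc n)  = refl
  ⟦⟧-neg -[1+ n ]   = sym (-‿involutive _)

  -- Integer multiplication multiplies signs and absolute values, so multiplicativity is proved on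
  -- the two parts separately.
  ⟦_⟧ₛ : Sign → Carrier
  ⟦ Sign.+ ⟧ₛ = 1#
  ⟦ Sign.- ⟧ₛ = - 1#

  ⟦⟧ₛ-* : ∀ s t → ⟦ s Sign.* t ⟧ₛ ≈ ⟦ s ⟧ₛ * ⟦ t ⟧ₛ
  ⟦⟧ₛ-* Sign.+ t      = sym (*-identityˡ _)
  ⟦⟧ₛ-* Sign.- Sign.+ = sym (*-identityʳ _)
  ⟦⟧ₛ-* Sign.- Sign.- = sym (trans (-1*x≈-x _) (-‿involutive 1#))

  ⟦⟧-◃ : ∀ s n → ⟦ s ℤ.◃ n ⟧ ≈ ⟦ s ⟧ₛ * (n · 1#)
  ⟦⟧-◃ s      zero    = sym (zeroʳ _)
  ⟦⟧-◃ Sign.+ (suc n) = sym (*-identityˡ _)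
  ⟦⟧-◃ Sign.- (suc n) = sym (-1*x≈-x _)

  ⟦⟧-sign-abs : ∀ i → ⟦ i ⟧ ≈ ⟦ ℤ.sign i ⟧ₛ * (ℤ.∣ i ∣ · 1#)
  ⟦⟧-sign-abs i = begin
    ⟦ i ⟧                           ≡⟨ ≡.cong ⟦_⟧ (ℤ.signᵢ◃∣i∣≡i i) ⟨
    ⟦ ℤ.sign i ℤ.◃ ℤ.∣ i ∣ ⟧        ≈⟨ ⟦⟧-◃ (ℤ.sign i) ℤ.∣ i ∣ ⟩
    ⟦ ℤ.sign i ⟧ₛ * (ℤ.∣ i ∣ · 1#)  ∎

  ⟦⟧-* : ∀ i j → ⟦ i ℤ.* j ⟧ ≈ ⟦ i ⟧ * ⟦ j ⟧
  ⟦⟧-* i j = begin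
    ⟦ i ℤ.* j ⟧                                     ≈⟨ ⟦⟧-◃ (ℤ.sign i Sign.* ℤ.sign j) (ℤ.∣ i ∣ ℕ.* ℤ.∣ j ∣) ⟩
    ⟦ ℤ.sign i Sign.* ℤ.sign j ⟧ₛ * ((ℤ.∣ i ∣ ℕ.* ℤ.∣ j ∣) · 1#)
      ≈⟨ *-cong (⟦⟧ₛ-* (ℤ.sign i) (ℤ.sign j)) (×1-homo-* ℤ.∣ i ∣ ℤ.∣ j ∣) ⟩
    (⟦ ℤ.sign i ⟧ₛ * ⟦ ℤ.sign j ⟧ₛ) * ((ℤ.∣ i ∣ · 1#) * (ℤ.∣ j ∣ · 1#))
      ≈⟨ *-interchange _ _ _ _ ⟩
    (⟦ ℤ.sign i ⟧ₛ * (ℤ.∣ i ∣ · 1#)) * (⟦ ℤ.sign j ⟧ₛ * (ℤ.∣ j ∣ · 1#))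
      ≈⟨ *-cong (⟦⟧-sign-abs i) (⟦⟧-sign-abs j) ⟨
    ⟦ i ⟧ * ⟦ j ⟧                                   ∎

  -- The solver needs coefficients with computing equality to cancel x - x, which
  -- rules out coefficients in R itself.
  morphism : ℤ.+-*-rawRing -Raw-AlmostCommutative⟶ fromCommutativeRing R
  morphism = record
    { ⟦_⟧    = ⟦_⟧
    ; +-homo = ⟦⟧-+
    ; *-homo = ⟦⟧-*
    ; -‿homo = ⟦⟧-neg
    ; 0-homo = refl
    ; 1-homo = +-identityʳ 1#
    }

  open Algebra.Solver.Ring ℤ.+-*-rawRing (fromCommutativeRing R) morphism
    (λ i j → Maybe.map (reflexive ∘ ≡.cong ⟦_⟧) (dec⇒maybe (i ℤ.≟ j))) public
    using (solve; _:=_; _:+_; _:*_; _:-_; :-_; con)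

-- Arithmetic of ordered fields

module OrderedFieldProperties {c ℓ₁ ℓ₂} (𝔽 : OrderedField c ℓ₁ ℓ₂) where

  open OrderedField 𝔽
  open IntegerCoefficients commutativeRing public using (solve; _:=_; _:+_; _:*_; _:-_; :-_; con)
  open DecTotalOrder decTotalOrder public
    using (_≤?_; poset; total; antisym; ≤-respˡ-≈; ≤-respʳ-≈)
    renaming (refl to ≤-refl; reflexive to ≤-reflexive; trans to ≤-trans)
  open Relation.Binary.Properties.DecTotalOrder decTotalOrder public
    using (<⇒≉; <⇒≱; ≰⇒>; ≤∧≉⇒<; <-respˡ-≈; <-strictTotalOrder; <-compare)
  open StrictTotalOrder <-strictTotalOrder public using (_<?_)
  open Relation.Binary.Construct.NonStrictToStrict _≈_ _≤_ using (<⇒≤) public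
  open Algebra.Construct.NaturalChoice.Max totalOrder public
    using (⊔-lub; x⊔y≤z⇒x≤z; x⊔y≤z⇒y≤z)
  open Algebra.Construct.NaturalChoice.Min totalOrder public
    using (⊓-glb; x⊓y≤x)
  module ≤-Reasoning = Relation.Binary.Reasoning.PartialOrder poset
  open ≤-Reasoning

  ≤-<-trans : ∀ {x y z} → x ≤ y → y < z → x < z
  ≤-<-trans x≤y y<z = ≤∧≉⇒< (≤-trans x≤y (<⇒≤ y<z))
    λ x≈z → <⇒≱ y<z (≤-respˡ-≈ x≈z x≤y)

  <-≤-trans : ∀ {x y z} → x < y → y ≤ z → x < z
  <-≤-trans x<y y≤z = ≤∧≉⇒< (≤-trans (<⇒≤ x<y) y≤z)
    λ x≈z → <⇒≱ x<y (≤-respʳ-≈ (sym x≈z) y≤z)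

  ≮⇒≥ : ∀ {x y} → ¬ (x < y) → y ≤ x
  ≮⇒≥ {x} {y} x≮y with y ≤? x
  ... | yes y≤x = y≤x
  ... | no  y≰x = contradiction (≰⇒> y≰x) x≮y

  +-monoˡ-≤ : ∀ x {y z} → y ≤ z → y + x ≤ z + x
  +-monoˡ-≤ x {y} {z} y≤z = begin
    y + x ≈⟨ +-comm y x ⟩
    x + y ≤⟨ +-monoʳ-≤ x y≤z ⟩
    x + z ≈⟨ +-comm x z ⟩
    z + x ∎

  +-mono-≤ : ∀ {x y x′ y′} → x ≤ y → x′ ≤ y′ → x + x′ ≤ y + y′
  +-mono-≤ x≤y x′≤y′ = ≤-trans (+-monoˡ-≤ _ x≤y) (+-monoʳ-≤ _ x′≤y′)

  +-cancelʳ-≤ : ∀ z {x y} → x + z ≤ y + z → x ≤ y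
  +-cancelʳ-≤ z {x} {y} x+z≤y+z = begin
    x           ≈⟨ solve 2 (λ x z → x := x :+ z :- z) refl x z ⟩
    x + z - z   ≤⟨ +-monoˡ-≤ (- z) x+z≤y+z ⟩
    y + z - z   ≈⟨ solve 2 (λ x z → x :+ z :- z := x) refl y z ⟩
    y           ∎

  x≤y⇒0≤y-x : ∀ {x y} → x ≤ y → 0# ≤ y - x
  x≤y⇒0≤y-x {x} x≤y = ≤-respˡ-≈ (-‿inverseʳ x) (+-monoˡ-≤ (- x) x≤y)

  -- Polynomial inequalities are proved by exhibiting the difference as a nonnegative p
  -- and leaving x + p ≈ y to the ring solver.
  x+p≈y⇒x≤y : ∀ {x y p} → 0# ≤ p → x + p ≈ y → x ≤ y
  x+p≈y⇒x≤y {x} {y} {p} 0≤p x+p≈y = begin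
    x      ≈⟨ +-identityʳ x ⟨
    x + 0# ≤⟨ +-monoʳ-≤ x 0≤p ⟩
    x + p  ≈⟨ x+p≈y ⟩
    y      ∎

  x<y⇒0<y-x : ∀ {x y} → x < y → 0# < y - x
  x<y⇒0<y-x {x} {y} x<y = ≤∧≉⇒< (x≤y⇒0≤y-x (<⇒≤ x<y)) λ 0≈y-x → <⇒≉ x<y (begin-equality
    x              ≈⟨ +-identityʳ x ⟨
    x + 0#         ≈⟨ +-congˡ 0≈y-x ⟩
    x + (y - x)    ≈⟨ solve 2 (λ x y → x :+ (y :- x) := y) refl x y ⟩
    y              ∎)

  +-nonNegative : ∀ {x y} → 0# ≤ x → 0# ≤ y → 0# ≤ x + y
  +-nonNegative 0≤x 0≤y = ≤-respˡ-≈ (+-identityˡ 0#) (+-mono-≤ 0≤x 0≤y)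

  +-positive : ∀ {x y} → 0# < x → 0# ≤ y → 0# < x + y
  +-positive {x} {y} 0<x 0≤y = <-≤-trans 0<x (x+p≈y⇒x≤y 0≤y refl)

  *-monoʳ-≤ : ∀ {x} → 0# ≤ x → ∀ {y z} → y ≤ z → x * y ≤ x * z
  *-monoʳ-≤ {x} 0≤x {y} {z} y≤z = x+p≈y⇒x≤y (*-nonNegative 0≤x (x≤y⇒0≤y-x y≤z))
    (solve 3 (λ x y z → x :* y :+ x :* (z :- y) := x :* z) refl x y z)

  *-monoˡ-≤ : ∀ {x} → 0# ≤ x → ∀ {y z} → y ≤ z → y * x ≤ z * x
  *-monoˡ-≤ {x} 0≤x {y} {z} y≤z = begin
    y * x ≈⟨ *-comm y x ⟩
    x * y ≤⟨ *-monoʳ-≤ 0≤x y≤z ⟩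
    x * z ≈⟨ *-comm x z ⟩
    z * x ∎

  *-mono-≤ : ∀ {x y x′ y′} → 0# ≤ y → 0# ≤ x′ → x ≤ y → x′ ≤ y′ → x * x′ ≤ y * y′
  *-mono-≤ 0≤y 0≤x′ x≤y x′≤y′ = ≤-trans (*-monoˡ-≤ 0≤x′ x≤y) (*-monoʳ-≤ 0≤y x′≤y′)

  neg-cancel-≤ : ∀ {x y} → - x ≤ - y → y ≤ x
  neg-cancel-≤ {x} {y} -x≤-y = x+p≈y⇒x≤y (x≤y⇒0≤y-x -x≤-y)
    (solve 2 (λ x y → y :+ (:- y :- :- x) := x) refl x y)

  0≤1 : 0# ≤ 1#
  0≤1 with total 0# 1#
  ... | inj₁ 0≤1 = 0≤1
  -- If `1# ≤ 0#`, the square of `0# - 1#` is nonnegative and equals `1#`. The unit enters the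
  -- solver as a variable because the solver's constant one denotes `1# + 0#`.
  ... | inj₂ 1≤0 = ≤-respʳ-≈
    (trans (solve 1 (λ e → (con (+ 0) :- e) :* (con (+ 0) :- e) := e :* e) refl 1#) (*-identityˡ 1#))
    (*-nonNegative (x≤y⇒0≤y-x 1≤0) (x≤y⇒0≤y-x 1≤0))

  0<1 : 0# < 1#
  0<1 = ≤∧≉⇒< 0≤1 0≉1

  0<⇒≉0 : ∀ {x} → 0# < x → ¬ (x ≈ 0#)
  0<⇒≉0 0<x = <⇒≉ 0<x ∘ sym

  *-inverseˡ : ∀ {x} → 0# < x → x ⁻¹ * x ≈ 1#
  *-inverseˡ {x} 0<x = trans (*-comm _ _) (*-inverseʳ (0<⇒≉0 0<x))

  x/y*y≈x : ∀ x {y} → 0# < y → x / y * y ≈ x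
  x/y*y≈x x 0<y = trans (*-assoc _ _ _) (trans (*-congˡ (*-inverseˡ 0<y)) (*-identityʳ x))

  *-positive : ∀ {x y} → 0# < x → 0# < y → 0# < x * y
  *-positive {x} {y} 0<x 0<y = ≤∧≉⇒< (*-nonNegative (<⇒≤ 0<x) (<⇒≤ 0<y)) λ 0≈xy →
    <⇒≉ 0<y (begin-equality
      0#              ≈⟨ zeroʳ _ ⟨
      x ⁻¹ * 0#       ≈⟨ *-congˡ 0≈xy ⟩
      x ⁻¹ * (x * y)  ≈⟨ *-assoc _ _ _ ⟨
      x ⁻¹ * x * y    ≈⟨ *-congʳ (*-inverseˡ 0<x) ⟩
      1# * y          ≈⟨ *-identityˡ y ⟩
      y               ∎)

  ⁻¹-nonNegative : ∀ {x} → 0# < x → 0# ≤ x ⁻¹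
  ⁻¹-nonNegative {x} 0<x with total 0# (x ⁻¹)
  ... | inj₁ 0≤x⁻¹ = 0≤x⁻¹
  ... | inj₂ x⁻¹≤0 = contradiction 1≤0 (<⇒≱ 0<1)
    where
    1≤0 : 1# ≤ 0#
    1≤0 = begin
      1#        ≈⟨ *-inverseˡ 0<x ⟨
      x ⁻¹ * x  ≤⟨ *-monoˡ-≤ (<⇒≤ 0<x) x⁻¹≤0 ⟩
      0# * x    ≈⟨ zeroˡ x ⟩
      0#        ∎

  /-nonNegative : ∀ {x y} → 0# ≤ x → 0# < y → 0# ≤ x / y
  /-nonNegative 0≤x 0<y = *-nonNegative 0≤x (⁻¹-nonNegative 0<y)

  /-monoˡ-≤ : ∀ {x y z} → 0# < z → x ≤ y → x / z ≤ y / z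
  /-monoˡ-≤ 0<z = *-monoˡ-≤ (⁻¹-nonNegative 0<z)

  x*y/y≈x : ∀ x {y} → 0# < y → x * y / y ≈ x
  x*y/y≈x x 0<y = trans (*-assoc _ _ _) (trans (*-congˡ (*-inverseʳ (0<⇒≉0 0<y))) (*-identityʳ x))

  x*y≤z⇒x≤z/y : ∀ {x y z} → 0# < y → x * y ≤ z → x ≤ z / y
  x*y≤z⇒x≤z/y 0<y xy≤z = ≤-respˡ-≈ (x*y/y≈x _ 0<y) (/-monoˡ-≤ 0<y xy≤z)

  x≤z*y⇒x/y≤z : ∀ {x y z} → 0# < y → x ≤ z * y → x / y ≤ z
  x≤z*y⇒x/y≤z 0<y x≤zy = ≤-respʳ-≈ (x*y/y≈x _ 0<y) (/-monoˡ-≤ 0<y x≤zy)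

  /-antimonoʳ-≤ : ∀ {a x y} → 0# ≤ a → 0# < y → y ≤ x → a / x ≤ a / y
  /-antimonoʳ-≤ {a} {x} {y} 0≤a 0<y y≤x = x≤z*y⇒x/y≤z (<-≤-trans 0<y y≤x) (begin
    a            ≈⟨ x/y*y≈x a 0<y ⟨
    a / y * y    ≤⟨ *-monoʳ-≤ (/-nonNegative 0≤a 0<y) y≤x ⟩
    a / y * x    ∎)

  ∣x∣≤y⇒x≤y : ∀ {x y} → ∣ x ∣ ≤ y → x ≤ y
  ∣x∣≤y⇒x≤y = x⊔y≤z⇒x≤z _ _

  ∣x∣≤y⇒-x≤y : ∀ {x y} → ∣ x ∣ ≤ y → - x ≤ y
  ∣x∣≤y⇒-x≤y = x⊔y≤z⇒y≤z _ _

  0≤x⇒∣x∣≤x : ∀ {x} → 0# ≤ x → ∣ x ∣ ≤ x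
  0≤x⇒∣x∣≤x {x} 0≤x = ⊔-lub ≤-refl (x+p≈y⇒x≤y (+-nonNegative 0≤x 0≤x)
    (solve 1 (λ x → :- x :+ (x :+ x) := x) refl x))

  fromℕ-nonNegative : ∀ k → 0# ≤ fromℕ k
  fromℕ-nonNegative zero    = ≤-refl
  fromℕ-nonNegative (suc k) = +-nonNegative 0≤1 (fromℕ-nonNegative k)

  fromℕ-positive : ∀ {k} → Fin k → 0# < fromℕ k
  fromℕ-positive {suc k} _ = +-positive 0<1 (fromℕ-nonNegative k)

  fromℕ-mono-≤ : ∀ {j k} → j ≤ℕ k → fromℕ j ≤ fromℕ k
  fromℕ-mono-≤ {k = k} ℕ.z≤n     = fromℕ-nonNegative k
  fromℕ-mono-≤         (ℕ.s≤s p) = +-monoʳ-≤ 1# (fromℕ-mono-≤ p)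

  -- Stands in for a continuity argument. Strictness at the upper end alone already makes the
  -- denominator `q - p` positive.
  interpolate : ∀ {p q x} → p ≤ x → x < q →
                ∃ λ t → 0# ≤ t × t ≤ 1# × (1# - t) * p + t * q ≈ x
  interpolate {p} {q} {x} p≤x x<q =
    t , /-nonNegative 0≤x-p 0<q-p
      , x≤z*y⇒x/y≤z 0<q-p (≤-respʳ-≈ (sym (*-identityˡ _)) (+-monoˡ-≤ (- p) (<⇒≤ x<q)))
      , (begin-equality
          (1# - t) * p + t * q  ≈⟨ solve 4 (λ p q t e → (e :- t) :* p :+ t :* q := t :* (q :- p) :+ e :* p) refl p q t 1# ⟩
          t * (q - p) + 1# * p  ≈⟨ +-cong (x/y*y≈x _ 0<q-p) (*-identityˡ p) ⟩
          (x - p) + p           ≈⟨ solve 2 (λ p x → (x :- p) :+ p := x) refl p x ⟩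
          x                     ∎)
    where
    0≤x-p : 0# ≤ x - p
    0≤x-p = x≤y⇒0≤y-x p≤x
    0<q-p : 0# < q - p
    0<q-p = x<y⇒0<y-x (≤-<-trans p≤x x<q)
    t : Carrier
    t = (x - p) / (q - p)

-- Finite sums, prefix sums and extrema

module Sums {c ℓ₁ ℓ₂} (𝔽 : OrderedField c ℓ₁ ℓ₂) where

  open OrderedField 𝔽 hiding (zero)
  open OrderedFieldProperties 𝔽
  open Algebra.Properties.Semiring.Sum semiring
    using (sum-cong-≋; sum-replicate-zero; ∑-comm; ∑-distrib-+; *-distribˡ-sum)

  open Data.List.Extrema totalOrder
    using (argmax; argmax-all; f[xs]≤f[argmax]; xs≤max; max≤v⁺; min≤xs; v≤min⁺)

  sum-zero : ∀ {n} (f : Fin n → Carrier) → (∀ i → f i ≈ 0#) → sum f ≈ 0#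
  sum-zero {n} f f≈0 = trans (sum-cong-≋ f≈0) (sum-replicate-zero n)

  sum-mono-≤ : ∀ {n} {f g : Fin n → Carrier} → (∀ i → f i ≤ g i) → sum f ≤ sum g
  sum-mono-≤ {zero}  f≤g = ≤-refl
  sum-mono-≤ {suc n} f≤g = +-mono-≤ (f≤g zero) (sum-mono-≤ (f≤g ∘ suc))

  sum-single : ∀ {n} (f : Fin n → Carrier) k → (∀ j → ¬ (j ≡ k) → f j ≈ 0#) → sum f ≈ f k
  sum-single f zero    f≈0 =
    trans (+-congˡ (sum-zero (f ∘ suc) λ j → f≈0 (suc j) λ ())) (+-identityʳ _)
  sum-single f (suc k) f≈0 =
    trans (+-cong (f≈0 zero λ ()) (sum-single (f ∘ suc) k λ j j≢k → f≈0 (suc j) (j≢k ∘ Fin.suc-injective)))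
          (+-identityˡ _)

  if-yes : ∀ {p} {P : Set p} (P? : Dec P) → P → ∀ {x y : Carrier} →
           (if does P? then x else y) ≈ x
  if-yes (yes _) _ = refl
  if-yes (no ¬p) p = contradiction p ¬p

  if-no : ∀ {p} {P : Set p} (P? : Dec P) → ¬ P → ∀ {x y : Carrier} →
          (if does P? then x else y) ≈ y
  if-no (yes p) ¬p = contradiction p ¬p
  if-no (no _)  _  = refl

  if-⇔ : ∀ {p q} {P : Set p} {Q : Set q} (P? : Dec P) (Q? : Dec Q) → (P → Q) → (Q → P) →
         ∀ {x y : Carrier} → (if does P? then x else y) ≈ (if does Q? then x else y)
  if-⇔ (yes p) Q? P⇒Q _   = sym (if-yes Q? (P⇒Q p))
  if-⇔ (no ¬p) Q? _   Q⇒P = sym (if-no Q? (¬p ∘ Q⇒P))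

  restrict : ∀ {n} → Subset n → (Fin n → Carrier) → Fin n → Carrier
  restrict S f i = if does (i ∈? S) then f i else 0#

  module _ {n} (S : Subset n) where

    sumOver-cong : ∀ {f g} → (∀ i → i ∈ S → f i ≈ g i) → sumOver S f ≈ sumOver S g
    sumOver-cong f≈g = sum-cong-≋ pointwise
      where
      pointwise : ∀ i → (if does (i ∈? S) then _ else 0#) ≈ (if does (i ∈? S) then _ else 0#)
      pointwise i with i ∈? S
      ... | yes i∈S = f≈g i i∈S
      ... | no  _   = refl

    sumOver-mono-≤ : ∀ {f g} → (∀ i → i ∈ S → f i ≤ g i) → sumOver S f ≤ sumOver S g
    sumOver-mono-≤ f≤g = sum-mono-≤ pointwise
      where
      pointwise : ∀ i → (if does (i ∈? S) then _ else 0#) ≤ (if does (i ∈? S) then _ else 0#)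
      pointwise i with i ∈? S
      ... | yes i∈S = f≤g i i∈S
      ... | no  _   = ≤-refl

    sumOver-zero : ∀ {f} → (∀ i → i ∈ S → f i ≈ 0#) → sumOver S f ≈ 0#
    sumOver-zero f≈0 = sum-zero _ pointwise
      where
      pointwise : ∀ i → (if does (i ∈? S) then _ else 0#) ≈ 0#
      pointwise i with i ∈? S
      ... | yes i∈S = f≈0 i i∈S
      ... | no  _   = refl

    sumOver-nonNegative : ∀ {f} → (∀ i → i ∈ S → 0# ≤ f i) → 0# ≤ sumOver S f
    sumOver-nonNegative 0≤f = ≤-respˡ-≈ (sumOver-zero λ _ _ → refl) (sumOver-mono-≤ 0≤f)

    sumOver-+ : ∀ f g → sumOver S (λ i → f i + g i) ≈ sumOver S f + sumOver S g
    sumOver-+ f g = trans (sum-cong-≋ pointwise) (∑-distrib-+ (restrict S f) (restrict S g))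
      where
      pointwise : ∀ i → (if does (i ∈? S) then f i + g i else 0#) ≈
                        (if does (i ∈? S) then f i else 0#) + (if does (i ∈? S) then g i else 0#)
      pointwise i with i ∈? S
      ... | yes _ = refl
      ... | no  _ = sym (+-identityˡ 0#)

    sumOver-* : ∀ x f → sumOver S (λ i → x * f i) ≈ x * sumOver S f
    sumOver-* x f = trans (sum-cong-≋ pointwise) (sym (*-distribˡ-sum x (restrict S f)))
      where
      pointwise : ∀ i → (if does (i ∈? S) then x * f i else 0#) ≈ x * (if does (i ∈? S) then f i else 0#)
      pointwise i with i ∈? S
      ... | yes _ = refl
      ... | no  _ = sym (zeroʳ x)

    sumOver-linear : ∀ x f y g →
      sumOver S (λ i → x * f i + y * g i) ≈ x * sumOver S f + y * sumOver S g
    sumOver-linear x f y g = trans (sumOver-+ _ _) (+-cong (sumOver-* x f) (sumOver-* y g))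

  sumOver-⊤ : ∀ {n} (f : Fin n → Carrier) → sumOver ⊤ f ≈ sum f
  sumOver-⊤ {n} f = sum-cong-≋ {n} λ i → if-yes (i ∈? ⊤) ∈⊤

  -- At each index both sides have the same two terms: in swapped order on `S`, and equal by
  -- hypothesis off it. This localises a difference of totals to `S` without subtracting.
  sumOver-swap : ∀ {n} (S : Subset n) f g → (∀ i → i ∉ S → f i ≈ g i) →
                 sumOver ⊤ f + sumOver S g ≈ sumOver ⊤ g + sumOver S f
  sumOver-swap S f g f≈g = trans (+-congʳ (sumOver-⊤ f)) (trans (sym (∑-distrib-+ f (restrict S g)))
    (trans (sum-cong-≋ pointwise) (trans (∑-distrib-+ g (restrict S f)) (+-congʳ (sym (sumOver-⊤ g))))))
    where
    pointwise : ∀ i → f i + (if does (i ∈? S) then g i else 0#) ≈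
                      g i + (if does (i ∈? S) then f i else 0#)
    pointwise i with i ∈? S
    ... | yes _   = +-comm _ _
    ... | no  i∉S = +-congʳ (f≈g i i∉S)

  sumOver-1 : ∀ {n} (S : Subset n) → sumOver S (λ _ → 1#) ≈ fromℕ (card S)
  sumOver-1 []            = refl
  sumOver-1 (inside  ∷ S) = +-congˡ (sumOver-1 S)
  sumOver-1 (outside ∷ S) = trans (+-identityˡ _) (sumOver-1 S)

  -- Each `f i` is its own sum over all groups, since uniqueness leaves a single nonzero term; then
  -- the two sums are exchanged.
  sum-partition : ∀ {m n} (G : Fin m → Subset n) → (∀ i → ∃! _≡_ λ k → i ∈ G k) →
                  ∀ f → sumOver ⊤ f ≈ sum λ k → sumOver (G k) f
  sum-partition G partition f = begin-equality
    sumOver ⊤ f                                           ≈⟨ sumOver-⊤ f ⟩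
    sum f                                                 ≈⟨ sum-cong-≋ (λ i → single i (partition i)) ⟨
    sum (λ i → sum λ k → if does (i ∈? G k) then f i else 0#)  ≈⟨ ∑-comm (λ i k → if does (i ∈? G k) then f i else 0#) ⟩
    sum (λ k → sumOver (G k) f)                           ∎
    where
    open ≤-Reasoning
    single : ∀ i → ∃! _≡_ (λ k → i ∈ G k) →
             sum (λ k → if does (i ∈? G k) then f i else 0#) ≈ f i
    single i (k , i∈Gk , unique) = trans
      (sum-single _ k λ j j≢k → if-no (i ∈? G j) λ i∈Gj → j≢k (≡.sym (unique i∈Gj)))
      (if-yes (i ∈? G k) i∈Gk)

  sum≤ sum< : ∀ {m} → (Fin m → Carrier) → Fin m → Carrier
  sum≤ h k = sum λ j → if does (j Fin.≤? k) then h j else 0#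
  sum< h k = sum λ j → if does (j Fin.<? k) then h j else 0#

  sum≤≈sum<+ : ∀ {m} (h : Fin m → Carrier) k → sum≤ h k ≈ sum< h k + h k
  sum≤≈sum<+ h k = trans (sum-cong-≋ pointwise) (trans (∑-distrib-+ below at) (+-congˡ (trans
      (sum-single at k λ j j≢k → if-no (j Fin.≟ k) j≢k) (if-yes (k Fin.≟ k) ≡.refl))))
    where
    below at : Fin _ → Carrier
    below j = if does (j Fin.<? k) then h j else 0#
    at    j = if does (j Fin.≟ k) then h j else 0#
    pointwise : ∀ j → (if does (j Fin.≤? k) then h j else 0#) ≈
      below j + at j
    pointwise j with Fin.<-cmp j k
    ... | tri< j<k j≢k _ = trans (if-yes (j Fin.≤? k) (ℕ.<⇒≤ j<k))
      (sym (trans (+-cong (if-yes (j Fin.<? k) j<k) (if-no (j Fin.≟ k) j≢k)) (+-identityʳ _)))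
    ... | tri≈ j≮k j≡k _ = trans (if-yes (j Fin.≤? k) (ℕ.≤-reflexive (≡.cong Fin.toℕ j≡k)))
      (sym (trans (+-cong (if-no (j Fin.<? k) j≮k) (if-yes (j Fin.≟ k) j≡k)) (+-identityˡ _)))
    ... | tri> j≮k j≢k k<j = trans (if-no (j Fin.≤? k) (ℕ.<⇒≱ k<j))
      (sym (trans (+-cong (if-no (j Fin.<? k) j≮k) (if-no (j Fin.≟ k) j≢k)) (+-identityˡ _)))

  sum<-suc : ∀ {m} (h : Fin (suc m) → Carrier) k → sum< h (suc k) ≈ sum≤ h (Fin.inject₁ k)
  sum<-suc {m} h k = sum-cong-≋ {suc m} λ j → if-⇔ (j Fin.<? suc k) (j Fin.≤? Fin.inject₁ k)
    (λ j<1+k → ≡.subst (Fin.toℕ j ℕ.≤_) (≡.sym (Fin.toℕ-inject₁ k)) (ℕ.s≤s⁻¹ j<1+k))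
    (λ j≤k → ℕ.s≤s (≡.subst (Fin.toℕ j ℕ.≤_) (Fin.toℕ-inject₁ k) j≤k))
    {h j} {0#}

  -- For the first index the prefix is empty and `0# ≤ x` suffices. Otherwise it is the full prefix
  -- at the predecessor `Fin.inject₁ k`; if that exceeded `x`, minimality would put `suc k` below
  -- its own predecessor.
  sum<-least : ∀ {m} (h : Fin m → Carrier) k {x} → 0# ≤ x →
               (∀ j → x < sum≤ h j → k Fin.≤ j) → sum< h k ≤ x
  sum<-least {suc m} h zero 0≤x _ =
    ≤-respˡ-≈ (sym (sum-zero {suc m} (λ j → if does (j Fin.<? zero {m}) then h j else 0#)
      λ j → if-no (j Fin.<? zero {m}) (λ ()) {h j} {0#})) 0≤x
  sum<-least h (suc k) 0≤x least = ≤-respˡ-≈ (sym (sum<-suc h k)) (≮⇒≥ λ x<sum →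
    ℕ.<-irrefl ≡.refl (≡.subst (suc (Fin.toℕ k) ℕ.≤_) (Fin.toℕ-inject₁ k) (least _ x<sum)))

  module _ {n} {p} {P : Fin n → Set p} (P? : Decidable P) (f : Fin n → Carrier) where

    -- The search needs a starting item; the given witness of `P` serves as one, so the result
    -- satisfies `P` whichever item wins.
    argmax∃ : ∃ P → ∃ λ i → P i × ∀ j → P j → f j ≤ f i
    argmax∃ (i₀ , Pi₀) =
      argmax f i₀ candidates
      , argmax-all f {P = P} Pi₀ (All.tabulate λ i∈ → proj₂ (∈-filter⁻ P? {xs = allFin n} i∈))
      , λ j Pj → All.lookup (f[xs]≤f[argmax] i₀ candidates) (∈-filter⁺ P? (∈-allFin j) Pj)
      where
      candidates = filter P? (allFin n)

  module _ {n} (S : Subset n) (S≠∅ : Nonempty S) (f : Fin n → Carrier) where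

    private
      -- Unfolds to the same list as the private `image` behind `maxOver` and `minOver`, so facts
      -- about list extrema apply directly.
      members : List Carrier
      members = map f (filter (_∈? S) (allFin n))

      ∈-members : ∀ {i} → i ∈ S → f i ∈ᴸ members
      ∈-members {i} i∈S = ∈-map⁺ f (∈-filter⁺ (_∈? S) (∈-allFin i) i∈S)

      All-members : ∀ {p} {P : Carrier → Set p} → (∀ i → i ∈ S → P (f i)) → All P members
      All-members Pf = All.map⁺ (All.tabulate λ {i} i∈ → Pf i (proj₂ (∈-filter⁻ (_∈? S) {xs = allFin n} i∈)))

    ≤-maxOver : ∀ i → i ∈ S → f i ≤ maxOver S S≠∅ f
    ≤-maxOver i i∈S = All.lookup (xs≤max _ members) (∈-members i∈S)

    maxOver-≤ : ∀ {x} → (∀ i → i ∈ S → f i ≤ x) → maxOver S S≠∅ f ≤ x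
    maxOver-≤ f≤x = max≤v⁺ (f≤x _ (proj₂ S≠∅)) (All-members f≤x)

    minOver-≤ : ∀ i → i ∈ S → minOver S S≠∅ f ≤ f i
    minOver-≤ i i∈S = All.lookup (min≤xs _ members) (∈-members i∈S)

    ≤-minOver : ∀ {x} → (∀ i → i ∈ S → x ≤ f i) → x ≤ minOver S S≠∅ f
    ≤-minOver x≤f = v≤min⁺ (x≤f _ (proj₂ S≠∅)) (All-members x≤f)

module KnapsackProperties {c ℓ₁ ℓ₂} (𝔽 : OrderedField c ℓ₁ ℓ₂) where

  open OrderedField 𝔽 hiding (zero)
  open OrderedFieldProperties 𝔽
  open Sums 𝔽
  open Knapsack 𝔽
  open ≤-Reasoning

  -- Threshold allocations and their optimality

  module InstanceProperties {a ℓ Lᵥ L_w} (I : Instance a ℓ Lᵥ L_w) where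

    open Instance I

    w-positive : ∀ i → 0# < w i
    w-positive i = <-≤-trans wₘᵢₙ-positive (wᴬ-bounded _)

    ρ*w≈v : ∀ i → ρ i * w i ≈ v i
    ρ*w≈v i = x/y*y≈x _ (w-positive i)

    ρ-positive : ∀ i → 0# < ρ i
    ρ-positive i = ≤∧≉⇒< (/-nonNegative (<⇒≤ (vᴬ-positive _)) (w-positive i)) λ 0≈ρ →
      <⇒≉ (vᴬ-positive (attr i)) (begin-equality
        0#        ≈⟨ zeroˡ _ ⟨
        0# * w i  ≈⟨ *-congʳ 0≈ρ ⟩
        ρ i * w i ≈⟨ ρ*w≈v i ⟩
        v i       ∎)

    weight-cong : ∀ S {y z} → (∀ i → i ∈ S → y i ≈ z i) → weight S y ≈ weight S z
    weight-cong S y≈z = sumOver-cong S λ i i∈S → *-congˡ (y≈z i i∈S)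

    value-cong : ∀ S {y z} → (∀ i → i ∈ S → y i ≈ z i) → value S y ≈ value S z
    value-cong S y≈z = sumOver-cong S λ i i∈S → *-congˡ (y≈z i i∈S)

    -- The box part of `Feasible`, kept apart from the budget because itemwise comparisons see one
    -- coordinate at a time.
    Bounded : Subset n → (Fin n → Carrier) → Set ℓ₂
    Bounded S z = ∀ i → i ∈ S → 0# ≤ z i × z i ≤ u i

    module _ (S : Subset n) (ν : Carrier) where

      -- Complementary slackness with `ν` as the price of the budget. Items of ratio exactly `ν`
      -- stay free, so that they can absorb the residual budget.
      Threshold : (Fin n → Carrier) → Set _
      Threshold z = ∀ i → i ∈ S → (ν < ρ i → z i ≈ u i) × (ρ i < ν → z i ≈ 0#)

      -- (v i - ν w i)(z i - z′ i) ≥ 0 for every item i, with the negative terms moved across.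
      threshold-exchange : ∀ {z z′} → Threshold z → Bounded S z′ →
        ∀ i → i ∈ S → v i * z′ i + ν * (w i * z i) ≤ v i * z i + ν * (w i * z′ i)
      threshold-exchange {z} {z′} thr bnd i i∈S = x+p≈y⇒x≤y p≥0 (begin-equality
        v i * z′ i + ν * (w i * z i) + (ρ i - ν) * (z i - z′ i) * w i
          ≈⟨ +-congʳ (+-congʳ (*-congʳ (ρ*w≈v i))) ⟨
        ρ i * w i * z′ i + ν * (w i * z i) + (ρ i - ν) * (z i - z′ i) * w i
          ≈⟨ solve 5 (λ ρ w z z′ ν → ρ :* w :* z′ :+ ν :* (w :* z) :+ (ρ :- ν) :* (z :- z′) :* w
                                       := ρ :* w :* z :+ ν :* (w :* z′))
                     refl (ρ i) (w i) (z i) (z′ i) ν ⟩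
        ρ i * w i * z i + ν * (w i * z′ i)
          ≈⟨ +-congʳ (*-congʳ (ρ*w≈v i)) ⟩
        v i * z i + ν * (w i * z′ i) ∎)
        where
        q≥0 : 0# ≤ (ρ i - ν) * (z i - z′ i)
        -- The factors never have opposite signs: above the threshold `z` is at its upper bound,
        -- below it at its lower bound, and at the threshold the first factor vanishes.
        q≥0 with <-compare ν (ρ i)
        ... | tri< ν<ρ _ _ = *-nonNegative (x≤y⇒0≤y-x (<⇒≤ ν<ρ))
          (x≤y⇒0≤y-x (≤-respʳ-≈ (sym (proj₁ (thr i i∈S) ν<ρ)) (proj₂ (bnd i i∈S))))
        ... | tri≈ _ ν≈ρ _ = ≤-reflexive (sym (begin-equality
          (ρ i - ν) * (z i - z′ i)    ≈⟨ *-congʳ (+-congʳ ν≈ρ) ⟨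
          (ν - ν) * (z i - z′ i)      ≈⟨ *-congʳ (-‿inverseʳ ν) ⟩
          0# * (z i - z′ i)           ≈⟨ zeroˡ _ ⟩
          0#                          ∎))
        ... | tri> _ _ ρ<ν = ≤-respʳ-≈
          (solve 4 (λ ρ ν z z′ → (ν :- ρ) :* (z′ :- z) := (ρ :- ν) :* (z :- z′)) refl (ρ i) ν (z i) (z′ i))
          (*-nonNegative (x≤y⇒0≤y-x (<⇒≤ ρ<ν))
            (x≤y⇒0≤y-x (≤-respˡ-≈ (sym (proj₂ (thr i i∈S) ρ<ν)) (proj₁ (bnd i i∈S)))))
        p≥0 : 0# ≤ (ρ i - ν) * (z i - z′ i) * w i
        p≥0 = *-nonNegative q≥0 (<⇒≤ (w-positive i))

      -- Lagrangian weak duality: in the summed exchange inequality, `z` pays exactly `ν * b` and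
      -- `z′` at most that, because the price is nonnegative.
      threshold-optimal : ∀ {b z} → 0# ≤ ν → Threshold z → weight S z ≈ b →
                          ∀ z′ → Feasible S b z′ → value S z′ ≤ value S z
      threshold-optimal {b} {z} 0≤ν thr full z′ (bnd , wz′≤b) = +-cancelʳ-≤ (ν * b) (begin
        value S z′ + ν * b            ≈⟨ +-congˡ (*-congˡ full) ⟨
        value S z′ + ν * weight S z   ≈⟨ +-congˡ (sumOver-* S ν _) ⟨
        value S z′ + sumOver S (λ i → ν * (w i * z i))  ≈⟨ sumOver-+ S _ _ ⟨
        sumOver S (λ i → v i * z′ i + ν * (w i * z i))  ≤⟨ sumOver-mono-≤ S (threshold-exchange thr bnd) ⟩
        sumOver S (λ i → v i * z i + ν * (w i * z′ i))  ≈⟨ sumOver-+ S _ _ ⟩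
        value S z + sumOver S (λ i → ν * (w i * z′ i))  ≈⟨ +-congˡ (sumOver-* S ν _) ⟩
        value S z + ν * weight S z′   ≤⟨ +-monoʳ-≤ _ (*-monoʳ-≤ 0≤ν wz′≤b) ⟩
        value S z + ν * b             ∎)

    -- The greedy solution on a set of items

    module _ (S : Subset n) (S≠∅ : Nonempty S) where

      -- The least and the greatest allocation between `0#` and `u` with threshold `ν`; they differ
      -- only on items of ratio exactly `ν`.
      above atLeast : Carrier → Fin n → Carrier
      above   ν i = if does (ν <? ρ i) then u i else 0#
      atLeast ν i = if does (ν ≤? ρ i) then u i else 0#

      weight-mono-≤ : ∀ {y z} → (∀ i → i ∈ S → y i ≤ z i) → weight S y ≤ weight S z
      weight-mono-≤ y≤z = sumOver-mono-≤ S λ i i∈S → *-monoʳ-≤ (<⇒≤ (w-positive i)) (y≤z i i∈S)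

      -- j is the item of largest ratio such that filling all items of ratio at least ρ j
      -- overflows the budget; the greedy solution interpolates between filling the items of
      -- ratio > ρ j and those of ratio ≥ ρ j, so no sorting and no tie-breaking is needed.
      greedy : ∀ {b} → 0# ≤ b → b < F S →
               ∃ λ j → j ∈ S × ∃ λ z → Bounded S z × weight S z ≈ b × Threshold S (ρ j) z
      greedy {b} 0≤b b<F = j , j∈S , z , z-bounded , z-full , λ i _ → z-saturated i , z-empty i
        where
        Overflows : Fin n → Set _
        Overflows i = i ∈ S × b < weight S (atLeast (ρ i))

        -- Minimising `ρ` is maximising `- ρ`. At the least ratio every item of `S` is filled, which
        -- weighs `F S` and exceeds `b`; hence the search for `critical` has a candidate.
        worst : ∃ λ i → i ∈ S × ∀ k → k ∈ S → - ρ k ≤ - ρ i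
        worst = argmax∃ (_∈? S) (λ i → - ρ i) S≠∅

        worst-overflows : Overflows (proj₁ worst)
        worst-overflows = proj₁ (proj₂ worst) , <-≤-trans b<F (weight-mono-≤ λ i i∈S →
          ≤-reflexive (sym (if-yes (_ ≤? ρ i) (neg-cancel-≤ (proj₂ (proj₂ worst) i i∈S)))))

        critical : ∃ λ i → Overflows i × ∀ k → Overflows k → ρ k ≤ ρ i
        critical = argmax∃ (λ i → (i ∈? S) ×-dec (b <? weight S (atLeast (ρ i)))) ρ (_ , worst-overflows)

        j = proj₁ critical
        j∈S = proj₁ (proj₁ (proj₂ critical))
        ν = ρ j

        -- If no ratio in `S` exceeds `ν`, the weight is zero. Otherwise let `k` have the least such
        -- ratio: no ratio in `S` lies strictly between `ν` and `ρ k`, so `atLeast (ρ k)` would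
        -- overflow too, against the maximality of `j`.
        above-no-overflow : ¬ (b < weight S (above ν))
        above-no-overflow b<above with Fin.any? (λ i → (i ∈? S) ×-dec (ν <? ρ i))
        ... | no ∄i = <⇒≱ b<above (≤-respˡ-≈ (sym (sumOver-zero S λ i i∈S →
              trans (*-congˡ (if-no (ν <? ρ i) λ ν<ρ → ∄i (i , i∈S , ν<ρ))) (zeroʳ _))) 0≤b)
        ... | yes ∃i with argmax∃ (λ i → (i ∈? S) ×-dec (ν <? ρ i)) (λ i → - ρ i) ∃i
        ...   | k , (k∈S , ν<ρk) , k-least = <⇒≱ ν<ρk (proj₂ (proj₂ critical) k (k∈S ,
                <-≤-trans b<above (weight-mono-≤ above≤atLeast)))
          where
          above≤atLeast : ∀ i → i ∈ S → above ν i ≤ atLeast (ρ k) i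
          above≤atLeast i i∈S with ν <? ρ i | ρ k ≤? ρ i
          ... | no  _   | yes _ = u-nonNegative i
          ... | no  _   | no  _ = ≤-refl
          ... | yes _   | yes _ = ≤-refl
          ... | yes ν<ρ | no ρk≰ρi = contradiction (neg-cancel-≤ (k-least i (i∈S , ν<ρ))) ρk≰ρi

        -- The two weights bracket `b`, strictly at the upper end. All tied items receive the same
        -- fraction `t` of their ceilings.
        mix = interpolate (≮⇒≥ above-no-overflow) (proj₂ (proj₁ (proj₂ critical)))
        t = proj₁ mix
        0≤t = proj₁ (proj₂ mix)
        0≤1-t = x≤y⇒0≤y-x (proj₁ (proj₂ (proj₂ mix)))

        z : Fin n → Carrier
        z i = (1# - t) * above ν i + t * atLeast ν i

        [1-t]x+tx≈x : ∀ x → (1# - t) * x + t * x ≈ x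
        [1-t]x+tx≈x x = trans (solve 3 (λ e t x → (e :- t) :* x :+ t :* x := e :* x) refl 1# t x) (*-identityˡ x)

        if-bounded : ∀ {p} {P : Set p} (P? : Dec P) i →
                     0# ≤ (if does P? then u i else 0#) × (if does P? then u i else 0#) ≤ u i
        if-bounded (yes _) i = u-nonNegative i , ≤-refl
        if-bounded (no _)  i = ≤-refl , u-nonNegative i

        z-bounded : Bounded S z
        z-bounded i _ =
          +-nonNegative (*-nonNegative 0≤1-t (proj₁ (if-bounded (ν <? ρ i) i)))
                        (*-nonNegative 0≤t (proj₁ (if-bounded (ν ≤? ρ i) i))) ,
          ≤-respʳ-≈ ([1-t]x+tx≈x (u i))
            (+-mono-≤ (*-monoʳ-≤ 0≤1-t (proj₂ (if-bounded (ν <? ρ i) i)))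
                      (*-monoʳ-≤ 0≤t (proj₂ (if-bounded (ν ≤? ρ i) i))))

        z-full : weight S z ≈ b
        z-full = begin-equality
          weight S z
            ≈⟨ sumOver-cong S (λ i _ → solve 5 (λ w s x t y → w :* (s :* x :+ t :* y) := s :* (w :* x) :+ t :* (w :* y))
                 refl (w i) (1# - t) (above ν i) t (atLeast ν i)) ⟩
          sumOver S (λ i → (1# - t) * (w i * above ν i) + t * (w i * atLeast ν i))
            ≈⟨ sumOver-linear S _ _ _ _ ⟩
          (1# - t) * weight S (above ν) + t * weight S (atLeast ν)
            ≈⟨ proj₂ (proj₂ (proj₂ mix)) ⟩
          b ∎

        z-saturated : ∀ i → ν < ρ i → z i ≈ u i
        z-saturated i ν<ρ = trans
          (+-cong (*-congˡ (if-yes (ν <? ρ i) ν<ρ)) (*-congˡ (if-yes (ν ≤? ρ i) (<⇒≤ ν<ρ))))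
          ([1-t]x+tx≈x (u i))

        z-empty : ∀ i → ρ i < ν → z i ≈ 0#
        z-empty i ρ<ν = trans
          (+-cong (*-congˡ (if-no (ν <? ρ i) λ ν<ρ → <⇒≱ ν<ρ (<⇒≤ ρ<ν))) (*-congˡ (if-no (ν ≤? ρ i) (<⇒≱ ρ<ν))))
          ([1-t]x+tx≈x 0#)

    -- Comparison of two allocations of equal weight

    module _ (S : Subset n) {y y′ : Fin n → Carrier} (y-bounded : Bounded S y) (y′-bounded : Bounded S y′) where

      ∣y-y′∣≤u : ∀ i → i ∈ S → y i - y′ i ≤ u i × y′ i - y i ≤ u i
      ∣y-y′∣≤u i i∈S with y-bounded i i∈S | y′-bounded i i∈S
      ... | 0≤y , y≤u | 0≤y′ , y′≤u =
        x+p≈y⇒x≤y (+-nonNegative 0≤y′ (x≤y⇒0≤y-x y≤u))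
          (solve 3 (λ y y′ u → y :- y′ :+ (y′ :+ (u :- y)) := u) refl (y i) (y′ i) (u i)) ,
        x+p≈y⇒x≤y (+-nonNegative 0≤y (x≤y⇒0≤y-x y′≤u))
          (solve 3 (λ y y′ u → y′ :- y :+ (y :+ (u :- y′)) := u) refl (y i) (y′ i) (u i))

      -- The worst weight in the itemwise inequality is w = q where y ≥ y′ and w = p where
      -- y ≤ y′; the term 2 w (y - y′) sums to zero.
      amount-difference : ∀ {p q} → q ≤ p → 0# < p + q → (∀ i → i ∈ S → q ≤ w i × w i ≤ p) →
        weight S y ≈ weight S y′ →
        sumOver S y ≤ sumOver S y′ + U S * ((p - q) / (p + q))
      amount-difference {p} {q} q≤p 0<p+q w-bounded equal-weight =
        ≤-respʳ-≈ (begin-equality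
          ((p + q) * Y′ + (p - q) * U S) / (p + q)
            ≈⟨ solve 5 (λ s Y′ d u s⁻¹ → (s :* Y′ :+ d :* u) :* s⁻¹ := Y′ :* s :* s⁻¹ :+ u :* (d :* s⁻¹))
                 refl (p + q) Y′ (p - q) (U S) ((p + q) ⁻¹) ⟩
          Y′ * (p + q) / (p + q) + U S * ((p - q) / (p + q))
            ≈⟨ +-congʳ (x*y/y≈x Y′ 0<p+q) ⟩
          Y′ + U S * ((p - q) / (p + q)) ∎)
        -- Twice the common weight is added on both sides, then written with `y′` on the left and
        -- `y` on the right, so that the claim splits into itemwise inequalities.
        (x*y≤z⇒x≤z/y 0<p+q (+-cancelʳ-≤ (2# * weight S y) (begin
          Y * (p + q) + 2# * weight S y
            ≈⟨ +-cong (*-comm _ _) (*-congˡ equal-weight) ⟩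
          (p + q) * Y + 2# * weight S y′
            ≈⟨ sumOver-linear S (p + q) y 2# _ ⟨
          sumOver S (λ i → (p + q) * y i + 2# * (w i * y′ i))
            ≤⟨ sumOver-mono-≤ S pointwise ⟩
          sumOver S (λ i → ((p + q) * y′ i + (p - q) * u i) + 2# * (w i * y i))
            ≈⟨ trans (sumOver-+ S _ _) (+-cong (sumOver-linear S (p + q) y′ (p - q) u) (sumOver-* S 2# _)) ⟩
          ((p + q) * Y′ + (p - q) * U S) + 2# * weight S y ∎)))
        where
        -- Unfolds to the same `2 · 1#` that `con (+ 2)` denotes, so the solver's output matches.
        2# = fromℕ 2
        Y = sumOver S y
        Y′ = sumOver S y′
        pointwise : ∀ i → i ∈ S → (p + q) * y i + 2# * (w i * y′ i) ≤
                                  ((p + q) * y′ i + (p - q) * u i) + 2# * (w i * y i)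
        pointwise i i∈S with w-bounded i i∈S | ∣y-y′∣≤u i i∈S | total (y′ i) (y i)
        -- The slack comes from `p + q - 2 w = (p - q) - 2 (w - q)`; the other case uses
        -- `2 w - (p + q) = (p - q) - 2 (p - w)`.
        ... | q≤w , w≤p | y-y′≤u , y′-y≤u | inj₁ y′≤y = x+p≈y⇒x≤y
          (+-nonNegative (*-nonNegative (+-nonNegative (x≤y⇒0≤y-x q≤w) (x≤y⇒0≤y-x q≤w)) (x≤y⇒0≤y-x y′≤y))
                         (*-nonNegative (x≤y⇒0≤y-x q≤p) (x≤y⇒0≤y-x y-y′≤u)))
          (solve 6 (λ p q w y y′ u →
              ((p :+ q) :* y :+ con (+ 2) :* (w :* y′)) :+
                (((w :- q) :+ (w :- q)) :* (y :- y′) :+ (p :- q) :* (u :- (y :- y′)))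
              := ((p :+ q) :* y′ :+ (p :- q) :* u) :+ con (+ 2) :* (w :* y))
            refl p q (w i) (y i) (y′ i) (u i))
        ... | q≤w , w≤p | y-y′≤u , y′-y≤u | inj₂ y≤y′ = x+p≈y⇒x≤y
          (+-nonNegative (*-nonNegative (+-nonNegative (x≤y⇒0≤y-x w≤p) (x≤y⇒0≤y-x w≤p)) (x≤y⇒0≤y-x y≤y′))
                         (*-nonNegative (x≤y⇒0≤y-x q≤p) (x≤y⇒0≤y-x y′-y≤u)))
          (solve 6 (λ p q w y y′ u →
              ((p :+ q) :* y :+ con (+ 2) :* (w :* y′)) :+
                (((p :- w) :+ (p :- w)) :* (y′ :- y) :+ (p :- q) :* (u :- (y′ :- y)))
              := ((p :+ q) :* y′ :+ (p :- q) :* u) :+ con (+ 2) :* (w :* y))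
            refl p q (w i) (y i) (y′ i) (u i))

      -- Itemwise `(v - v̂)(y - y′)` is at most `ε` times the distance of `y` and `y′`, hence at
      -- most `ε u`; negative terms are moved across.
      value-difference : ∀ {v̂ ε} → 0# ≤ ε → (∀ i → i ∈ S → v i ≤ v̂ + ε × v̂ ≤ v i + ε) →
        value S y + v̂ * sumOver S y′ ≤ value S y′ + (v̂ * sumOver S y + ε * U S)
      value-difference {v̂} {ε} 0≤ε v-close = begin
        value S y + v̂ * sumOver S y′
          ≈⟨ trans (sumOver-+ S _ _) (+-congˡ (sumOver-* S v̂ y′)) ⟨
        sumOver S (λ i → v i * y i + v̂ * y′ i)
          ≤⟨ sumOver-mono-≤ S pointwise ⟩
        sumOver S (λ i → v i * y′ i + (v̂ * y i + ε * u i))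
          ≈⟨ trans (sumOver-+ S _ _) (+-congˡ (sumOver-linear S v̂ y ε u)) ⟩
        value S y′ + (v̂ * sumOver S y + ε * U S) ∎
        where
        pointwise : ∀ i → i ∈ S → v i * y i + v̂ * y′ i ≤ v i * y′ i + (v̂ * y i + ε * u i)
        pointwise i i∈S with v-close i i∈S | ∣y-y′∣≤u i i∈S | total (y′ i) (y i)
        ... | v≤v̂+ε , _ | y-y′≤u , _ | inj₁ y′≤y = x+p≈y⇒x≤y
          (+-nonNegative (*-nonNegative (x≤y⇒0≤y-x v≤v̂+ε) (x≤y⇒0≤y-x y′≤y))
                         (*-nonNegative 0≤ε (x≤y⇒0≤y-x y-y′≤u)))
          (solve 6 (λ v v̂ ε y y′ u →
              v :* y :+ v̂ :* y′ :+ ((v̂ :+ ε :- v) :* (y :- y′) :+ ε :* (u :- (y :- y′)))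
              := v :* y′ :+ (v̂ :* y :+ ε :* u))
            refl (v i) v̂ ε (y i) (y′ i) (u i))
        ... | _ , v̂≤v+ε | _ , y′-y≤u | inj₂ y≤y′ = x+p≈y⇒x≤y
          (+-nonNegative (*-nonNegative (x≤y⇒0≤y-x v̂≤v+ε) (x≤y⇒0≤y-x y≤y′))
                         (*-nonNegative 0≤ε (x≤y⇒0≤y-x y′-y≤u)))
          (solve 6 (λ v v̂ ε y y′ u →
              v :* y :+ v̂ :* y′ :+ ((v :+ ε :- v̂) :* (y′ :- y) :+ ε :* (u :- (y′ :- y)))
              := v :* y′ :+ (v̂ :* y :+ ε :* u))
            refl (v i) v̂ ε (y i) (y′ i) (u i))

      -- Once every value is replaced by the constant `v̂`, only the total amounts matter, and
      -- `amount-difference` bounds these.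
      value-difference-bound : ∀ {p q v̂ ε} → q ≤ p → 0# < p + q → (∀ i → i ∈ S → q ≤ w i × w i ≤ p) →
        0# ≤ v̂ → 0# ≤ ε → (∀ i → i ∈ S → v i ≤ v̂ + ε × v̂ ≤ v i + ε) →
        weight S y ≈ weight S y′ →
        value S y ≤ value S y′ + U S * (v̂ * ((p - q) / (p + q)) + ε)
      value-difference-bound {p} {q} {v̂} {ε} q≤p 0<p+q w-bounded 0≤v̂ 0≤ε v-close equal-weight =
        +-cancelʳ-≤ (v̂ * Y′) (begin
          value S y + v̂ * Y′
            ≤⟨ value-difference 0≤ε v-close ⟩
          value S y′ + (v̂ * sumOver S y + ε * U S)
            ≤⟨ +-monoʳ-≤ _ (+-monoˡ-≤ _ (*-monoʳ-≤ 0≤v̂ (amount-difference q≤p 0<p+q w-bounded equal-weight))) ⟩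
          value S y′ + (v̂ * (Y′ + U S * s) + ε * U S)
            ≈⟨ solve 6 (λ V v̂ Y u s ε → V :+ (v̂ :* (Y :+ u :* s) :+ ε :* u) := V :+ u :* (v̂ :* s :+ ε) :+ v̂ :* Y)
                 refl (value S y′) v̂ Y′ (U S) s ε ⟩
          value S y′ + U S * (v̂ * s + ε) + v̂ * Y′ ∎)
        where
        s = (p - q) / (p + q)
        Y′ = sumOver S y′

  -- The grouped allocation and its boundary group

  module AllocationProperties {a ℓ Lᵥ L_w δ} {I : Instance a ℓ Lᵥ L_w} {𝒢 : MetricGrouping I δ}
                              (𝒜 : GroupedAllocation 𝒢) where

    open Instance I
    open MetricGrouping 𝒢
    open GroupedAllocation 𝒜
    open InstanceProperties I

    ∈G⇒groupOf≡ : ∀ {i k} → i ∈ G k → groupOf i ≡ k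
    ∈G⇒groupOf≡ {i} = proj₂ (proj₂ (partition i))

    ∈G-groupOf : ∀ i → i ∈ G (groupOf i)
    ∈G-groupOf i = proj₁ (proj₂ (partition i))

    groupOf≡⇒∈G : ∀ {i k} → groupOf i ≡ k → i ∈ G k
    groupOf≡⇒∈G {i} eq = ≡.subst (λ k → i ∈ G k) eq (∈G-groupOf i)

    -- `zᵍᵖ` with its boundary part made a parameter, so that the optimum and the grouped allocation
    -- are two instances of one construction.
    splice : (Fin n → Carrier) → Fin n → Carrier
    splice y i with Fin.<-cmp (groupOf i) k⋆
    ... | tri< _ _ _ = u i
    ... | tri≈ _ _ _ = y i
    ... | tri> _ _ _ = 0#

    zᵍᵖ≈splice : ∀ i → zᵍᵖ i ≈ splice (WaterLevel.allocation waterLevel) i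
    zᵍᵖ≈splice i with Fin.<-cmp (groupOf i) k⋆
    ... | tri< _ _ _ = refl
    ... | tri≈ _ _ _ = refl
    ... | tri> _ _ _ = refl

    splice-Γ⁻ : ∀ y i → i ∈Γ⁻ → splice y i ≈ u i
    splice-Γ⁻ y i (j , j<k⋆ , i∈Gj) with Fin.<-cmp (groupOf i) k⋆ | ∈G⇒groupOf≡ i∈Gj
    ... | tri< _ _ _   | _      = refl
    ... | tri≈ ≮ _ _   | ≡.refl = contradiction j<k⋆ ≮
    ... | tri> ≮ _ _   | ≡.refl = contradiction j<k⋆ ≮

    splice-Γ : ∀ y i → i ∈ Γ → splice y i ≈ y i
    splice-Γ y i i∈Γ with Fin.<-cmp (groupOf i) k⋆
    ... | tri< _ ≢ _ = contradiction (∈G⇒groupOf≡ i∈Γ) ≢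
    ... | tri≈ _ _ _ = refl
    ... | tri> _ ≢ _ = contradiction (∈G⇒groupOf≡ i∈Γ) ≢

    splice-Γ⁺ : ∀ y i → i ∈Γ⁺ → splice y i ≈ 0#
    splice-Γ⁺ y i (j , k⋆<j , i∈Gj) with Fin.<-cmp (groupOf i) k⋆ | ∈G⇒groupOf≡ i∈Gj
    ... | tri< _ _ ≯   | ≡.refl = contradiction k⋆<j ≯
    ... | tri≈ _ _ ≯   | ≡.refl = contradiction k⋆<j ≯
    ... | tri> _ _ _   | _      = refl

    splice-outside : ∀ y y′ i → i ∉ Γ → splice y i ≈ splice y′ i
    splice-outside y y′ i i∉Γ with Fin.<-cmp (groupOf i) k⋆
    ... | tri< _ _ _ = refl
    ... | tri≈ _ eq _ = contradiction (groupOf≡⇒∈G eq) i∉Γ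
    ... | tri> _ _ _ = refl

    splice-bounded : ∀ {y} → Bounded Γ y → Bounded [n] (splice y)
    splice-bounded bnd i _ with Fin.<-cmp (groupOf i) k⋆
    ... | tri< _ _ _ = u-nonNegative i , ≤-refl
    ... | tri≈ _ eq _ = bnd i (groupOf≡⇒∈G eq)
    ... | tri> _ _ _ = ≤-refl , u-nonNegative i

    -- An item of a better group has ratio at least the maximum over `Γ`, so it cannot fall below
    -- `ρ j`; dually for worse groups. Ratios equal to `ρ j` are harmless, since a threshold leaves
    -- them free.
    splice-threshold : OrderCompatible → ∀ {j y} → j ∈ Γ → Threshold Γ (ρ j) y →
                       Threshold [n] (ρ j) (splice y)
    splice-threshold compatible {j} {y} j∈Γ thr i _ with Fin.<-cmp (groupOf i) k⋆
    ... | tri< i<k⋆ _ _ = (λ _ → refl) , λ ρi<ρj → contradiction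
      (≤-trans (≤-maxOver Γ (nonempty k⋆) ρ j j∈Γ) (≤-trans (compatible (groupOf i) k⋆ i<k⋆)
        (minOver-≤ _ (nonempty (groupOf i)) ρ i (∈G-groupOf i)))) (<⇒≱ ρi<ρj)
    ... | tri≈ _ eq _    = thr i (groupOf≡⇒∈G eq)
    ... | tri> _ _ k⋆<i = (λ ρj<ρi → contradiction
      (≤-trans (≤-maxOver _ (nonempty (groupOf i)) ρ i (∈G-groupOf i)) (≤-trans (compatible k⋆ (groupOf i) k⋆<i)
        (minOver-≤ Γ (nonempty k⋆) ρ j j∈Γ))) (<⇒≱ ρj<ρi)) , λ _ → refl

    -- Summing by groups, those after `k⋆` contribute zero and those before it their full `F`.
    weight-splice : ∀ y → weight [n] (splice y) ≈ F< k⋆ + weight Γ y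
    weight-splice y = begin-equality
      weight [n] (splice y)       ≈⟨ sum-partition G partition _ ⟩
      sum h                       ≈⟨ sum-cong-≋ (λ k → upTo k) ⟨
      sum≤ h k⋆                   ≈⟨ sum≤≈sum<+ h k⋆ ⟩
      sum< h k⋆ + h k⋆            ≈⟨ +-cong (sum-cong-≋ (λ k → below k)) (weight-cong Γ (splice-Γ y)) ⟩
      F< k⋆ + weight Γ y          ∎
      where
      open Algebra.Properties.Semiring.Sum semiring using (sum-cong-≋)
      h : Fin m → Carrier
      h k = weight (G k) (splice y)
      upTo : ∀ k → (if does (k Fin.≤? k⋆) then h k else 0#) ≈ h k
      upTo k with Fin.<-cmp k⋆ k
      ... | tri< k⋆<k _ _ = trans (if-no (k Fin.≤? k⋆) (ℕ.<⇒≱ k⋆<k)) (sym (sumOver-zero (G k) λ i i∈Gk →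
        trans (*-congˡ (splice-Γ⁺ y i (k , k⋆<k , i∈Gk))) (zeroʳ _)))
      ... | tri≈ k⋆≮k _ _ = if-yes (k Fin.≤? k⋆) (ℕ.≮⇒≥ k⋆≮k)
      ... | tri> k⋆≮k _ _ = if-yes (k Fin.≤? k⋆) (ℕ.≮⇒≥ k⋆≮k)
      below : ∀ k → (if does (k Fin.<? k⋆) then h k else 0#) ≈ (if does (k Fin.<? k⋆) then F (G k) else 0#)
      below k = helper (k Fin.<? k⋆)
        where
        helper : (d : Dec (k Fin.< k⋆)) → (if does d then h k else 0#) ≈ (if does d then F (G k) else 0#)
        helper (yes k<k⋆) = weight-cong (G k) λ i i∈Gk → splice-Γ⁻ y i (k , k<k⋆ , i∈Gk)
        helper (no _)     = refl

    splice-full : ∀ {y} → weight Γ y ≈ c⋆ → weight [n] (splice y) ≈ C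
    splice-full {y} full = begin-equality
      weight [n] (splice y)   ≈⟨ weight-splice y ⟩
      F< k⋆ + weight Γ y      ≈⟨ +-congˡ full ⟩
      F< k⋆ + (C - F< k⋆)     ≈⟨ solve 2 (λ f c → f :+ (c :- f) := c) refl (F< k⋆) C ⟩
      C                       ∎

    c⋆-nonNegative : 0# ≤ c⋆
    c⋆-nonNegative = x≤y⇒0≤y-x (sum<-least (F ∘ G) k⋆ C-nonNegative k⋆-least)

    c⋆<F : c⋆ < F Γ
    c⋆<F = ≰⇒> λ F≤c⋆ → <⇒≱ k⋆-exceeds (begin
      F≤ k⋆                 ≈⟨ sum≤≈sum<+ (F ∘ G) k⋆ ⟩
      F< k⋆ + F Γ           ≤⟨ +-monoʳ-≤ _ F≤c⋆ ⟩
      F< k⋆ + (C - F< k⋆)   ≈⟨ solve 2 (λ f c → f :+ (c :- f) := c) refl (F< k⋆) C ⟩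
      C                     ∎)

    allocation : Fin n → Carrier
    allocation = WaterLevel.allocation waterLevel

    allocation-bounded : Bounded Γ allocation
    allocation-bounded i _ =
      ⊓-glb (u-nonNegative i) (WaterLevel.ζ-nonNegative waterLevel) , x⊓y≤x (u i) _

    zᵍᵖ-feasible : Feasible [n] C zᵍᵖ
    zᵍᵖ-feasible =
      (λ i i∈ → let (l , r) = splice-bounded allocation-bounded i i∈ in
        ≤-respʳ-≈ (sym (zᵍᵖ≈splice i)) l , ≤-respˡ-≈ (sym (zᵍᵖ≈splice i)) r) ,
      ≤-reflexive (trans (weight-cong [n] λ i _ → zᵍᵖ≈splice i) (splice-full (WaterLevel.fills waterLevel)))

    item : Fin n
    item = proj₁ (nonempty k⋆)

    item∈Γ : item ∈ Γ
    item∈Γ = proj₂ (nonempty k⋆)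

    w-range : ∀ i → i ∈ Γ → w⁻ k⋆ ≤ w i × w i ≤ w⁺ k⋆
    w-range i i∈Γ = minOver-≤ Γ (nonempty k⋆) w i i∈Γ , ≤-maxOver Γ (nonempty k⋆) w i i∈Γ

    w⁻≤w⁺ : w⁻ k⋆ ≤ w⁺ k⋆
    w⁻≤w⁺ = ≤-trans (proj₁ (w-range item item∈Γ)) (proj₂ (w-range item item∈Γ))

    wₘᵢₙ≤w⁻ : wₘᵢₙ ≤ w⁻ k⋆
    wₘᵢₙ≤w⁻ = ≤-minOver Γ (nonempty k⋆) w λ _ _ → wᴬ-bounded _

    w⁺+w⁻-positive : 0# < w⁺ k⋆ + w⁻ k⋆
    w⁺+w⁻-positive = +-positive (<-≤-trans 0<w⁻ w⁻≤w⁺) (<⇒≤ 0<w⁻)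
      where
      0<w⁻ : 0# < w⁻ k⋆
      0<w⁻ = <-≤-trans wₘᵢₙ-positive wₘᵢₙ≤w⁻

    spread-nonNegative : 0# ≤ spread
    spread-nonNegative = /-nonNegative (x≤y⇒0≤y-x w⁻≤w⁺) w⁺+w⁻-positive

    δ-nonNegative : 0# ≤ δ
    δ-nonNegative = <⇒≤ δ-positive

    εᵥ-nonNegative : 0# ≤ εᵥ
    εᵥ-nonNegative = *-nonNegative Lᵥ-nonNegative δ-nonNegative

    close : ∀ {f : A → Carrier} {L} → 0# ≤ L → (∀ x y → ∣ f x - f y ∣ ≤ L * d x y) →
            ∀ i → i ∈ Γ → f (attr i) ≤ f (rep k⋆) + L * δ × f (rep k⋆) ≤ f (attr i) + L * δ
    close {f} {L} 0≤L lipschitz i i∈Γ =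
      x+p≈y⇒x≤y (x≤y⇒0≤y-x (∣x∣≤y⇒x≤y ∣f-f∣≤Lδ))
        (solve 3 (λ x y z → x :+ (z :- (x :- y)) := y :+ z) refl (f (attr i)) (f (rep k⋆)) (L * δ)) ,
      x+p≈y⇒x≤y (x≤y⇒0≤y-x (∣x∣≤y⇒-x≤y ∣f-f∣≤Lδ))
        (solve 3 (λ x y z → y :+ (z :- (:- (x :- y))) := x :+ z) refl (f (attr i)) (f (rep k⋆)) (L * δ))
      where
      ∣f-f∣≤Lδ : ∣ f (attr i) - f (rep k⋆) ∣ ≤ L * δ
      ∣f-f∣≤Lδ = ≤-trans (lipschitz _ _) (*-monoʳ-≤ 0≤L (rep-close k⋆ i i∈Γ))

    -- Weights in `Γ` lie within `L_w * δ` of the representative's, so the numerator is at most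
    -- twice that; the denominator is at least twice `wₘᵢₙ`, and the twos cancel.
    spread≤ : spread ≤ L_w * δ / wₘᵢₙ
    spread≤ = x≤z*y⇒x/y≤z w⁺+w⁻-positive (begin
      w⁺ k⋆ - w⁻ k⋆
        ≤⟨ x+p≈y⇒x≤y (+-nonNegative (x≤y⇒0≤y-x w⁺≤) (x≤y⇒0≤y-x ≤w⁻))
             (solve 4 (λ p q r e → p :- q :+ (r :+ e :- p :+ (q :- (r :- e))) := e :+ e)
               refl (w⁺ k⋆) (w⁻ k⋆) (wᴬ (rep k⋆)) (L_w * δ)) ⟩
      L_w * δ + L_w * δ
        ≈⟨ +-cong (x/y*y≈x _ wₘᵢₙ-positive) (x/y*y≈x _ wₘᵢₙ-positive) ⟨
      r * wₘᵢₙ + r * wₘᵢₙ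
        ≈⟨ distribˡ r wₘᵢₙ wₘᵢₙ ⟨
      r * (wₘᵢₙ + wₘᵢₙ)
        ≤⟨ *-monoʳ-≤ 0≤r (+-mono-≤ (≤-trans wₘᵢₙ≤w⁻ w⁻≤w⁺) wₘᵢₙ≤w⁻) ⟩
      r * (w⁺ k⋆ + w⁻ k⋆) ∎)
      where
      r : Carrier
      r = L_w * δ / wₘᵢₙ
      0≤r : 0# ≤ r
      0≤r = /-nonNegative (*-nonNegative L_w-nonNegative δ-nonNegative) wₘᵢₙ-positive
      w-close : ∀ i → i ∈ Γ → w i ≤ wᴬ (rep k⋆) + L_w * δ × wᴬ (rep k⋆) ≤ w i + L_w * δ
      w-close = close {wᴬ} L_w-nonNegative wᴬ-lipschitz
      w⁺≤ : w⁺ k⋆ ≤ wᴬ (rep k⋆) + L_w * δ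
      w⁺≤ = maxOver-≤ Γ (nonempty k⋆) w λ i i∈Γ → proj₁ (w-close i i∈Γ)
      ≤w⁻ : wᴬ (rep k⋆) - L_w * δ ≤ w⁻ k⋆
      ≤w⁻ = ≤-minOver Γ (nonempty k⋆) w λ i i∈Γ → x+p≈y⇒x≤y (x≤y⇒0≤y-x (proj₂ (w-close i i∈Γ)))
        (solve 3 (λ r e w → r :- e :+ (w :+ e :- r) := w) refl (wᴬ (rep k⋆)) (L_w * δ) (w i))

    lossRate : Carrier
    lossRate = v̂ k⋆ * spread + εᵥ

    v̂-positive : 0# < v̂ k⋆
    v̂-positive = vᴬ-positive (rep k⋆)

    lossRate-nonNegative : 0# ≤ lossRate
    lossRate-nonNegative = +-nonNegative (*-nonNegative (<⇒≤ v̂-positive) spread-nonNegative) εᵥ-nonNegative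

    lossRate≤ : lossRate ≤ (v̂ k⋆ * L_w / wₘᵢₙ + Lᵥ) * δ
    lossRate≤ = begin
      v̂ k⋆ * spread + Lᵥ * δ
        ≤⟨ +-monoˡ-≤ _ (*-monoʳ-≤ (<⇒≤ v̂-positive) spread≤) ⟩
      v̂ k⋆ * (L_w * δ / wₘᵢₙ) + Lᵥ * δ
        ≈⟨ solve 5 (λ v Lw Lv δ r → v :* (Lw :* δ :* r) :+ Lv :* δ := (v :* Lw :* r :+ Lv) :* δ)
             refl (v̂ k⋆) L_w Lᵥ δ (wₘᵢₙ ⁻¹) ⟩
      (v̂ k⋆ * L_w / wₘᵢₙ + Lᵥ) * δ ∎

    U-nonNegative : 0# ≤ U Γ
    U-nonNegative = sumOver-nonNegative Γ λ i _ → u-nonNegative i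

    U≤ : ∀ K → (∀ k → card (G k) ≤ℕ K) → U Γ ≤ fromℕ K
    U≤ K sizes = begin
      U Γ                         ≤⟨ sumOver-mono-≤ Γ (λ i _ → u≤1 i) ⟩
      sumOver Γ (λ _ → 1#)        ≈⟨ sumOver-1 Γ ⟩
      fromℕ (card Γ)              ≤⟨ fromℕ-mono-≤ (sizes k⋆) ⟩
      fromℕ K                     ∎

    n-positive : 0# < fromℕ n
    n-positive = fromℕ-positive item

    -- At price zero every item has a larger ratio and is saturated, so the optimal allocation would
    -- weigh `F [n]`, more than the budget.
    multiplier-positive : C < F [n] → ∀ {ν} → IsMultiplier ν → 0# < ν
    multiplier-positive C<F {ν} (0≤ν , z , ((_ , wz≤C) , _) , _ , saturated , _) =
      ≤∧≉⇒< 0≤ν λ 0≈ν → <⇒≱ C<F (≤-respˡ-≈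
        (weight-cong [n] λ i _ → saturated i (<-respˡ-≈ 0≈ν (ρ-positive i))) wz≤C)

    -- By slackness `ν * C` is what the multiplier's own optimum pays for its weight, and each item
    -- pays at most its value: an item with ratio below `ν` is empty.
    multiplier-value : ∀ {ν V⋆} → IsMultiplier ν → IsV⋆ V⋆ → ν * C ≤ V⋆
    multiplier-value {ν} {V⋆} (0≤ν , z , (feasible , _) , slack , _ , empty) (_ , maximal) = begin
      ν * C                               ≈⟨ solve 3 (λ ν c w → ν :* c := ν :* w :+ ν :* (c :- w)) refl ν C (weight [n] z) ⟩
      ν * weight [n] z + ν * (C - weight [n] z)  ≈⟨ trans (+-congˡ slack) (+-identityʳ _) ⟩
      ν * weight [n] z                    ≈⟨ sumOver-* [n] ν _ ⟨
      sumOver [n] (λ i → ν * (w i * z i)) ≤⟨ sumOver-mono-≤ [n] pointwise ⟩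
      value [n] z                         ≤⟨ maximal z feasible ⟩
      V⋆                                  ∎
      where
      pointwise : ∀ i → i ∈ [n] → ν * (w i * z i) ≤ v i * z i
      pointwise i i∈ with ρ i <? ν
      ... | yes ρ<ν = ≤-reflexive (begin-equality
        ν * (w i * z i) ≈⟨ *-congˡ (trans (*-congˡ (empty i ρ<ν)) (zeroʳ _)) ⟩
        ν * 0#          ≈⟨ trans (zeroʳ ν) (sym (zeroʳ _)) ⟩
        v i * 0#        ≈⟨ *-congˡ (empty i ρ<ν) ⟨
        v i * z i       ∎)
      ... | no ρ≮ν = begin
        ν * (w i * z i)   ≤⟨ *-monoˡ-≤ (*-nonNegative (<⇒≤ (w-positive i)) (proj₁ (proj₁ feasible i i∈))) (≮⇒≥ ρ≮ν) ⟩
        ρ i * (w i * z i) ≈⟨ *-assoc _ _ _ ⟨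
        ρ i * w i * z i   ≈⟨ *-congʳ (ρ*w≈v i) ⟩
        v i * z i         ∎

    -- The loss under order compatibility

    module _ (compatible : OrderCompatible) where

      private
        solution = greedy Γ (nonempty k⋆) c⋆-nonNegative c⋆<F
        j = proj₁ solution
        j∈Γ = proj₁ (proj₂ solution)
        y = proj₁ (proj₂ (proj₂ solution))
        y-bounded = proj₁ (proj₂ (proj₂ (proj₂ solution)))
        y-full = proj₁ (proj₂ (proj₂ (proj₂ (proj₂ solution))))
        y-threshold = proj₂ (proj₂ (proj₂ (proj₂ (proj₂ solution))))

      z⋆ : Fin n → Carrier
      z⋆ = splice y

      z⋆-optimal : Optimal z⋆
      z⋆-optimal =
        (splice-bounded y-bounded , ≤-reflexive (splice-full y-full)) ,
        threshold-optimal [n] (ρ j) (<⇒≤ (ρ-positive j)) (splice-threshold compatible j∈Γ y-threshold) (splice-full y-full)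

      weight-z⋆ : weight Γ z⋆ ≈ c⋆
      weight-z⋆ = trans (weight-cong Γ (splice-Γ y)) y-full

      z⋆≈zᵍᵖ : ∀ i → i ∉ Γ → z⋆ i ≈ zᵍᵖ i
      z⋆≈zᵍᵖ i i∉Γ = trans (splice-outside y allocation i i∉Γ) (sym (zᵍᵖ≈splice i))

      -- The threshold that certifies `z⋆` globally also certifies `y` within `Γ`; this supplies the
      -- maximum in the intra-group loss.
      y-maxValue : IsMaxValue Γ c⋆ (value Γ y)
      y-maxValue =
        (y , (y-bounded , ≤-reflexive y-full) , refl) ,
        threshold-optimal Γ (ρ j) (<⇒≤ (ρ-positive j)) y-threshold y-full

      module _ {V⋆} (isV⋆ : IsV⋆ V⋆) where

        V⋆≈ : V⋆ ≈ value [n] z⋆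
        V⋆≈ = let ((x , feasible , value≈V⋆) , maximal) = isV⋆ in
          antisym (≤-respˡ-≈ value≈V⋆ (proj₂ z⋆-optimal x feasible)) (maximal z⋆ (proj₁ z⋆-optimal))

        E : Carrier
        E = V⋆ - Vᵍᵖ

        -- Lets the absolute value in the asymptotic statement be replaced by the one-sided bound.
        E-nonNegative : 0# ≤ E
        E-nonNegative = x≤y⇒0≤y-x (proj₂ isV⋆ zᵍᵖ zᵍᵖ-feasible)

        E≈Δ : E ≈ value Γ y - value Γ allocation
        E≈Δ = begin-equality
          V⋆ - Vᵍᵖ
            ≈⟨ +-congʳ V⋆≈ ⟩
          value [n] z⋆ - Vᵍᵖ
            -- The term `value Γ zᵍᵖ` is added and subtracted to reach the form of `sumOver-swap`.
            ≈⟨ solve 3 (λ x y z → x :- y := x :+ z :- (y :+ z)) refl (value [n] z⋆) Vᵍᵖ (value Γ zᵍᵖ) ⟩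
          value [n] z⋆ + value Γ zᵍᵖ - (Vᵍᵖ + value Γ zᵍᵖ)
            ≈⟨ +-congʳ (sumOver-swap Γ _ _ λ i i∉Γ → *-congˡ (z⋆≈zᵍᵖ i i∉Γ)) ⟩
          Vᵍᵖ + value Γ z⋆ - (Vᵍᵖ + value Γ zᵍᵖ)
            ≈⟨ solve 3 (λ x y z → x :+ y :- (x :+ z) := y :- z) refl Vᵍᵖ (value Γ z⋆) (value Γ zᵍᵖ) ⟩
          value Γ z⋆ - value Γ zᵍᵖ
            ≈⟨ +-cong (value-cong Γ (splice-Γ y)) (-‿cong (value-cong Γ λ i i∈Γ →
                 trans (zᵍᵖ≈splice i) (splice-Γ allocation i i∈Γ))) ⟩
          value Γ y - value Γ allocation ∎

        E≤ : E ≤ U Γ * lossRate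
        E≤ = begin
          E                               ≈⟨ E≈Δ ⟩
          value Γ y - value Γ allocation
            ≤⟨ +-monoˡ-≤ _ (value-difference-bound Γ y-bounded allocation-bounded w⁻≤w⁺ w⁺+w⁻-positive w-range
                 (<⇒≤ v̂-positive) εᵥ-nonNegative (close {vᴬ} Lᵥ-nonNegative vᴬ-lipschitz)
                 (trans y-full (sym (WaterLevel.fills waterLevel)))) ⟩
          value Γ allocation + U Γ * lossRate - value Γ allocation
            ≈⟨ solve 2 (λ x y → x :+ y :- x := y) refl (value Γ allocation) (U Γ * lossRate) ⟩
          U Γ * lossRate                  ∎

        E/n≤sizeBound : ∀ K → (∀ k → card (G k) ≤ℕ K) → E / fromℕ n ≤ sizeBound K
        E/n≤sizeBound K sizes = begin
          E / fromℕ n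
            ≤⟨ /-monoˡ-≤ n-positive (≤-trans E≤
                 (*-mono-≤ (fromℕ-nonNegative K) lossRate-nonNegative (U≤ K sizes) lossRate≤)) ⟩
          fromℕ K * ((v̂ k⋆ * L_w / wₘᵢₙ + Lᵥ) * δ) / fromℕ n
            ≈⟨ solve 4 (λ k r δ n⁻¹ → k :* (r :* δ) :* n⁻¹ := k :* n⁻¹ :* r :* δ)
                 refl (fromℕ K) (v̂ k⋆ * L_w / wₘᵢₙ + Lᵥ) δ (fromℕ n ⁻¹) ⟩
          sizeBound K ∎

        -- `V⋆` is positive because it is at least `ν * C`. The absolute bound is rewritten as the
        -- claimed ratio times `ν * C`, which is then enlarged to `V⋆`.
        relative-loss : C < F [n] → 0# < C → ∀ ν → IsMultiplier ν →
                        E / V⋆ ≤ U Γ / C * (v̂ k⋆ / ν) * (spread + εᵥ / v̂ k⋆)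
        relative-loss C<F 0<C ν isν = x≤z*y⇒x/y≤z (<-≤-trans (*-positive 0<ν 0<C) νC≤V⋆) (begin
          E                ≤⟨ E≤ ⟩
          U Γ * (v̂ k⋆ * spread + εᵥ)
            ≈⟨ *-cong (x/y*y≈x _ 0<C) (+-congˡ (x/y*y≈x _ v̂-positive)) ⟨
          U Γ / C * C * (v̂ k⋆ * spread + εᵥ / v̂ k⋆ * v̂ k⋆)
            ≈⟨ solve 5 (λ a c v s e → a :* c :* (v :* s :+ e :* v) := a :* v :* (s :+ e) :* c)
                 refl (U Γ / C) C (v̂ k⋆) spread (εᵥ / v̂ k⋆) ⟩
          U Γ / C * v̂ k⋆ * (spread + εᵥ / v̂ k⋆) * C
            ≈⟨ *-congʳ (*-congʳ (*-congˡ (x/y*y≈x _ 0<ν))) ⟨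
          U Γ / C * (v̂ k⋆ / ν * ν) * (spread + εᵥ / v̂ k⋆) * C
            ≈⟨ solve 5 (λ a b ν s c → a :* (b :* ν) :* s :* c := a :* b :* s :* (ν :* c))
                 refl (U Γ / C) (v̂ k⋆ / ν) ν (spread + εᵥ / v̂ k⋆) C ⟩
          U Γ / C * (v̂ k⋆ / ν) * (spread + εᵥ / v̂ k⋆) * (ν * C)
            ≤⟨ *-monoʳ-≤ bound-nonNegative νC≤V⋆ ⟩
          U Γ / C * (v̂ k⋆ / ν) * (spread + εᵥ / v̂ k⋆) * V⋆ ∎)
          where
          0<ν : 0# < ν
          0<ν = multiplier-positive C<F isν
          νC≤V⋆ : ν * C ≤ V⋆
          νC≤V⋆ = multiplier-value isν isV⋆
          bound-nonNegative : 0# ≤ U Γ / C * (v̂ k⋆ / ν) * (spread + εᵥ / v̂ k⋆)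
          bound-nonNegative = *-nonNegative
            (*-nonNegative (/-nonNegative U-nonNegative 0<C) (/-nonNegative (<⇒≤ v̂-positive) 0<ν))
            (+-nonNegative spread-nonNegative (/-nonNegative εᵥ-nonNegative v̂-positive))

    -- The bound in the group size, uniform over instances

    K/n-nonNegative : ∀ K → 0# ≤ fromℕ K / fromℕ n
    K/n-nonNegative K = /-nonNegative (fromℕ-nonNegative K) n-positive

    sizeBound-nonNegative : ∀ K → 0# ≤ sizeBound K
    sizeBound-nonNegative K = *-nonNegative (*-nonNegative (K/n-nonNegative K)
      (+-nonNegative (/-nonNegative (*-nonNegative (<⇒≤ v̂-positive) L_w-nonNegative) wₘᵢₙ-positive) Lᵥ-nonNegative))
      δ-nonNegative

    sizeBound≤ : ∀ {V̄ w̄} → 0# < w̄ → v̂ k⋆ ≤ V̄ → w̄ ≤ wₘᵢₙ → ∀ K →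
                 sizeBound K ≤ (V̄ * L_w / w̄ + Lᵥ) * δ * (fromℕ K / fromℕ n)
    sizeBound≤ {V̄} {w̄} 0<w̄ v̂≤V̄ w̄≤w K = begin
      fromℕ K / fromℕ n * (v̂ k⋆ * L_w / wₘᵢₙ + Lᵥ) * δ
        ≤⟨ *-monoˡ-≤ δ-nonNegative (*-monoʳ-≤ (K/n-nonNegative K) (+-monoˡ-≤ Lᵥ (begin
             v̂ k⋆ * L_w / wₘᵢₙ  ≤⟨ /-antimonoʳ-≤ (*-nonNegative (<⇒≤ v̂-positive) L_w-nonNegative) 0<w̄ w̄≤w ⟩
             v̂ k⋆ * L_w / w̄     ≤⟨ /-monoˡ-≤ 0<w̄ (*-monoˡ-≤ L_w-nonNegative v̂≤V̄) ⟩
             V̄ * L_w / w̄        ∎))) ⟩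
      fromℕ K / fromℕ n * (V̄ * L_w / w̄ + Lᵥ) * δ
        ≈⟨ solve 3 (λ k r δ → k :* r :* δ := r :* δ :* k) refl (fromℕ K / fromℕ n) (V̄ * L_w / w̄ + Lᵥ) δ ⟩
      (V̄ * L_w / w̄ + Lᵥ) * δ * (fromℕ K / fromℕ n) ∎

theorem12 :
  ∀ {c ℓ₁ ℓ₂ a ℓ : Level} (𝔽 : OrderedField c ℓ₁ ℓ₂) →
  let open OrderedField 𝔽
      open Knapsack 𝔽
  in
  (∀ {Lᵥ L_w δ : Carrier} (I : Instance a ℓ Lᵥ L_w) (𝒢 : MetricGrouping I δ)
     (𝒜 : GroupedAllocation 𝒢) →
     let open Instance I
         open MetricGrouping 𝒢
         open GroupedAllocation 𝒜
     in
     OrderCompatible → C < F [n] →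
     (∃ λ (z⋆ : Fin n → Carrier) →
          Optimal z⋆
        × (∀ i → i ∈Γ⁻ → z⋆ i ≈ u i)
        × (∀ i → i ∈Γ⁺ → z⋆ i ≈ 0#)
        × weight Γ z⋆ ≈ c⋆
        × (∀ i → i ∉ Γ → z⋆ i ≈ zᵍᵖ i))
     × (∀ (V⋆ : Carrier) → IsV⋆ V⋆ →
        let E = V⋆ - Vᵍᵖ in
          (∃ λ (Δ : Carrier) → IsIntraGroupLoss waterLevel Δ × E ≈ Δ)
        × E ≤ U Γ * (v̂ k⋆ * spread + εᵥ)
        × (∀ (K : ℕ) → (∀ k → card (G k) ≤ℕ K) → E / fromℕ n ≤ sizeBound K)
        × (0# < C → ∀ (ν⋆ : Carrier) → IsMultiplier ν⋆ →
           E / V⋆ ≤ U Γ / C * (v̂ k⋆ / ν⋆) * (spread + εᵥ / v̂ k⋆))))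
  ×
  (∀ (Lᵥ L_w δ V̄ w̄ : Carrier) → 0# < w̄ →
     ∃ λ (M : Carrier) →
     ∀ (I : Instance a ℓ Lᵥ L_w) (𝒢 : MetricGrouping I δ) (𝒜 : GroupedAllocation 𝒢) →
     let open Instance I
         open MetricGrouping 𝒢
         open GroupedAllocation 𝒜
     in
     OrderCompatible → C < F [n] → v̂ k⋆ ≤ V̄ → w̄ ≤ wₘᵢₙ →
     ∀ (K : ℕ) → (∀ k → card (G k) ≤ℕ K) →
       ∣ sizeBound K ∣ ≤ M * (fromℕ K / fromℕ n)
       × (∀ (V⋆ : Carrier) → IsV⋆ V⋆ →
          ∣ (V⋆ - Vᵍᵖ) / fromℕ n ∣ ≤ M * (fromℕ K / fromℕ n)))
theorem12 𝔽 =
  (λ I 𝒢 𝒜 compatible C<F →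
    let open AllocationProperties 𝒜 in
    ( z⋆ compatible , z⋆-optimal compatible
    , splice-Γ⁻ _ , splice-Γ⁺ _ , weight-z⋆ compatible , z⋆≈zᵍᵖ compatible)
    , λ V⋆ isV⋆ →
      (_ , (_ , y-maxValue compatible , refl) , E≈Δ compatible isV⋆)
      , E≤ compatible isV⋆
      , E/n≤sizeBound compatible isV⋆
      , relative-loss compatible isV⋆ C<F)
  -- The constant involves only data fixed before the instance is chosen, which is the required
  -- uniformity.
  , λ Lᵥ L_w δ V̄ w̄ 0<w̄ → (V̄ * L_w / w̄ + Lᵥ) * δ ,
    λ I 𝒢 𝒜 compatible C<F v̂≤V̄ w̄≤wₘᵢₙ K sizes →
    let open AllocationProperties 𝒜
        bound = sizeBound≤ 0<w̄ v̂≤V̄ w̄≤wₘᵢₙ K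
    in
    ≤-trans (0≤x⇒∣x∣≤x (sizeBound-nonNegative K)) bound
    , λ V⋆ isV⋆ → ≤-trans
        (0≤x⇒∣x∣≤x (/-nonNegative (E-nonNegative compatible isV⋆) n-positive))
        (≤-trans (E/n≤sizeBound compatible isV⋆ K sizes) bound)
  where
  open OrderedField 𝔽
  open OrderedFieldProperties 𝔽
  open KnapsackProperties 𝔽
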